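{- (a) For any locally finite quantifier theory $\mathbf A$ over $\mathcal S$ there is a global locally finite quantifier theory $\mathbf A'$ such that $\mathbf A=\mathbf A'|_{\mathcal S}$. (b) Any model of a global quantifier theory $\mathbf A'$ induces (by restriction to $\mathcal S\cup\{\emptyset\}$) a model of $\mathbf A'|_{\mathcal S}$, for any $\mathcal S$.
   Context: Throughout, $\mathcal S$ is a nonempty collection of sets containing at least one infinite set; $X,Y,Z,W$ denote members of $\mathcal S$ (sets of variables). Quantifier theory. A quantifier theory $\mathbf A$ over $\mathcal S$ consists of: a set $\mathbf A^*(X)$ and a map $\epsilon_X:X\to\mathbf A^*(X)$ for each $X$ (one writes $x$ for $\epsilon_X(x)$); a Boolean algebra $\mathbf A_*(X)$ for each $X$; an element $a\sigma\in\mathbf A^*(Y)$ for each nonempty $X$, $a\in\mathbf A^*(X)$ and map $\sigma:X\to\mathbf A^*(Y)$; an element $p\sigma\in\mathbf A_*(Y)$ for each nonempty $X$, $p\in\mathbf A_*(X)$ and map $\sigma:X\to\mathbf A^*(Y)$; an element $\forall x.p\in\mathbf A_*(X)$ for each nonempty $X$, $x\in X$, $p\in\mathbf A_*(X)$. Put $\mathbf A(X)=\mathbf A_*(X)\cup\mathbf A^*(X)$. For all nonempty $X$, $x\in X$, $t\in\mathbf A(X)$, $\sigma:X\to\mathbf A^*(Y)$, $p,q\in\mathbf A_*(X)$ the following hold. (P1) $t\epsilon_X=t$. (P2) $(t\sigma)\tau=t(\sigma\tau)$ if $Y$ is nonempty and $\tau:Y\to\mathbf A^*(W)$, where $(\sigma\tau)(x)=\sigma(x)\tau$.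 (P3) $x\sigma=\sigma(x)$. (P4) $p\mapsto p\sigma$ is a homomorphism of Boolean algebras $\mathbf A_*(X)\to\mathbf A_*(Y)$. (P5) $(\forall x.p)\sigma=\forall y.(p\sigma^{y/x})$ whenever $y,z\in Y$, $y\ne z$ and $\sigma[z/y]=\sigma$. (Q1) $\forall x.(p\wedge q)=\forall x.p\wedge\forall x.q$. (Q2) $\forall x.p\le p$. (Q3) $\forall x.p=p$ if $p[y/x]=p$ for some $y\in X$, $y\neq x$. Notation: for $y\in Y$ and $d\in\mathbf A^*(Y)$, $[d/y]:Y\to\mathbf A^*(Y)$ sends $y$ to $d$ and every other variable to itself; for $d\in \mathbf A^*(Y)$, $\sigma^{d/x}:X\to\mathbf A^*(Y)$ sends $x$ to $d$ and agrees with $\sigma$ elsewhere. Supports. For nonempty $X$ and $t\in\mathbf A(X)$, a subset $U\subseteq X$ is a support for $t$ if $t\sigma=t\tau$ for all $Y$ and all $\sigma,\tau:X\to\mathbf A^*(Y)$ with $\sigma|_U=\tau|_U$; $t$ is closed if $\emptyset$ is a support for $t$ (elements of $\mathbf A(\emptyset)$ are by definition closed). $\mathbf A$ is locally finite if every element of every $\mathbf A(X)$ has a finite support. Standing convention: every quantifier theory considered is nontrivial, meaning that $\mathbf A_*(X)$ has a non-closed element for some nonempty $X\in\mathcal S$. A quantifier theory is global if $\mathcal S$ is the collection of all sets. For a global theory $\mathbf A'$, $\mathbf A'|_{\mathcal S}$ denotes its restriction to $\mathcal S$ (keep only the data attached to members of $\mathcal S$); in (a) the identity $\mathbf A=\mathbf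 A'|_{\mathcal S}$ is understood up to isomorphism of quantifier theories over $\mathcal S$ (bijections on the $\mathbf A^*(X)$ and Boolean isomorphisms on the $\mathbf A_*(X)$ compatible with $\epsilon$, substitution and $\forall$). Models. A quantifier model is a quantifier theory $\mathbf B$ over a collection containing $\emptyset$ such that (M1) $\mathbf B^*(\emptyset)\neq\emptyset$ and $\mathbf B_*(\emptyset)$ is a nontrivial Boolean algebra ($0\ne1$); (M2) for nonempty $X$, $x\in X$, $p\in\mathbf B_*(X)$, $\sigma:X\to\mathbf B^*(\emptyset)$, the infimum $\bigwedge_{d\in\mathbf B^*(\emptyset)}p\sigma^{d/x}$ exists in $\mathbf B_*(\emptyset)$ and equals $(\forall x.p)\sigma$. A model of a quantifier theory $\mathbf A$ over $\mathcal S$ is a quantifier model $\mathbf B$ over $\mathcal S\cup\{\emptyset\}$ whose restriction to $\mathcal S\setminus\{\emptyset\}$ equals that of $\mathbf A$. -}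

module Defs where

open import Algebra.Lattice.Bundles using (BooleanAlgebra)
open import Algebra.Lattice.Morphism.Structures using (module LatticeMorphisms)
import Algebra.Lattice.Properties.Lattice as LatticeProperties
open import Axiom.ExcludedMiddle using (ExcludedMiddle)
open import Data.Bool.Base using (if_then_else_)
open import Data.Empty.Polymorphic using (⊥)
open import Data.Irrelevant using ([_])
open import Data.List.Base using (List)
open import Data.List.Membership.Propositional using (_∈_)
open import Data.Product.Base using (Σ-syntax; _×_; _,_)
open import Data.Refinement using (Refinement-syntax; _,_; value; refine)
open import Data.Sum.Base using (inj₁; inj₂)
open import Function.Base using (id; _∘_)
open import Function.Bundles using (_⇔_; Bijection)
open import Level using (Level; _⊔_; suc)
open import Relation.Binary.Bundles using (Setoid; Poset)
open import Relation.Binary.PropositionalEquality.Core using (_≡_; _≢_; refl; subst)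
open import Relation.Nullary using (¬_; does)
open import Relation.Unary using (Pred; _⊆_; _∪_; _∩_; ｛_｝; U; ∅)

------------------------------------------------------------------------
-- Sets of variables

record NonEmpty {ℓ : Level} (X : Set ℓ) : Set ℓ where
  constructor nonEmpty
  field witness : X

Finite : ∀ {ℓ u} {X : Set ℓ} → Pred X u → Set (ℓ ⊔ u)
Finite {X = X} P = Σ[ xs ∈ List X ] (∀ x → P x ⇔ x ∈ xs)

Infinite : ∀ {ℓ} → Set ℓ → Set ℓ
Infinite X = ¬ Finite (U {A = X})

-- A collection of sets is a predicate S on Set ℓ.  Membership proofs are
-- irrelevant, so that data indexed by the members of S depend only on the
-- sets themselves.

Member : ∀ {ℓ s} → Pred (Set ℓ) s → Set (suc ℓ ⊔ s)
Member {ℓ} S = [ X ∈ Set ℓ ∣ S X ]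

Var : ∀ {ℓ s} {S : Pred (Set ℓ) s} → Member S → Set ℓ
Var = value

HasInfiniteMember : ∀ {ℓ s} → Pred (Set ℓ) s → Set (suc ℓ ⊔ s)
HasInfiniteMember {ℓ} S = Σ[ X ∈ Set ℓ ] (S X × Infinite X)

-- Set ℓ has many empty types.  In S ∪ {∅} the type ⊥ plays the role of ∅,
-- whereas S ∖ {∅} has no empty type at all.

infixl 6 _∪∅ _∖∅

_∪∅ : ∀ {ℓ s} → Pred (Set ℓ) s → Pred (Set ℓ) (suc ℓ ⊔ s)
S ∪∅ = S ∪ ｛ ⊥ ｝

_∖∅ : ∀ {ℓ s} → Pred (Set ℓ) s → Pred (Set ℓ) (ℓ ⊔ s)
S ∖∅ = S ∩ NonEmpty

------------------------------------------------------------------------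
-- Boolean algebras

order : ∀ {c ℓ} → BooleanAlgebra c ℓ → Poset c ℓ ℓ
order B = LatticeProperties.poset (BooleanAlgebra.lattice B)

record IsBooleanHomomorphism {a b ℓ₁ ℓ₂ : Level}
         (A : BooleanAlgebra a ℓ₁) (B : BooleanAlgebra b ℓ₂)
         (f : BooleanAlgebra.Carrier A → BooleanAlgebra.Carrier B)
         : Set (a ⊔ ℓ₁ ⊔ ℓ₂) where
  private
    module A = BooleanAlgebra A
    module B = BooleanAlgebra B
  open LatticeMorphisms A.rawLattice B.rawLattice using (IsLatticeHomomorphism)
  field
    isLatticeHomomorphism : IsLatticeHomomorphism f
    ¬-homo                : ∀ p → f (A.¬ p) B.≈ B.¬ f p
    ⊤-homo                : f A.⊤ B.≈ B.⊤
    ⊥-homo                : f A.⊥ B.≈ B.⊥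

IsInfimum : ∀ {c ℓ₁ ℓ₂ i} (P : Poset c ℓ₁ ℓ₂) {I : Set i} →
            (I → Poset.Carrier P) → Poset.Carrier P → Set (c ⊔ ℓ₂ ⊔ i)
IsInfimum P f m = (∀ i → m ≤ f i) × (∀ l → (∀ i → l ≤ f i) → l ≤ m)
  where open Poset P using (_≤_)

------------------------------------------------------------------------
-- Excluded middle makes equality of variables decidable, which the
-- notation σ^{d/x} depends on.

module Theory {ℓ : Level} (em : ExcludedMiddle ℓ) where

  infixl 9 _⟨_↦_⟩

  _⟨_↦_⟩ : ∀ {b} {X : Set ℓ} {B : Set b} → (X → B) → X → B → (X → B)
  (σ ⟨ x ↦ d ⟩) z = if does (em {z ≡ x}) then d else σ z

  record QuantifierTheory {s : Level} (S : Pred (Set ℓ) s) : Set (suc ℓ ⊔ s) where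
    infix  4 _≈ᵗ_ _≈ᶠ_ _≤_ _≗ˢ_
    infix  8 _[_]ᵗ _[_]ᶠ _⊙_ _/_
    infixr 7 _∧_

    field
      terms    : Member S → Setoid ℓ ℓ
      formulas : Member S → BooleanAlgebra ℓ ℓ

    Term : Member S → Set ℓ
    Term X = Setoid.Carrier (terms X)

    Formula : Member S → Set ℓ
    Formula X = BooleanAlgebra.Carrier (formulas X)

    Subst : Member S → Member S → Set ℓ
    Subst X Y = Var X → Term Y

    _≈ᵗ_ : ∀ {X} → Term X → Term X → Set ℓ
    _≈ᵗ_ {X} = Setoid._≈_ (terms X)

    _≈ᶠ_ : ∀ {X} → Formula X → Formula X → Set ℓ
    _≈ᶠ_ {X} = BooleanAlgebra._≈_ (formulas X)

    _≤_ : ∀ {X} → Formula X → Formula X → Set ℓ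
    _≤_ {X} = Poset._≤_ (order (formulas X))

    _∧_ : ∀ {X} → Formula X → Formula X → Formula X
    _∧_ {X} = BooleanAlgebra._∧_ (formulas X)

    _≗ˢ_ : ∀ {X : Set ℓ} {Y} → (X → Term Y) → (X → Term Y) → Set ℓ
    σ ≗ˢ τ = ∀ x → σ x ≈ᵗ τ x

    field
      ε     : ∀ {X} → Subst X X
      _[_]ᵗ : ∀ {X Y} .{{_ : NonEmpty (Var X)}} → Term X → Subst X Y → Term Y
      _[_]ᶠ : ∀ {X Y} .{{_ : NonEmpty (Var X)}} → Formula X → Subst X Y → Formula Y
      all   : ∀ {X} → Var X → Formula X → Formula X

    _⊙_ : ∀ {X : Set ℓ} {Y W} .{{_ : NonEmpty (Var Y)}} →
          (X → Term Y) → Subst Y W → (X → Term W)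
    _⊙_ σ τ x = σ x [ τ ]ᵗ

    _/_ : ∀ {Y} → Term Y → Var Y → Subst Y Y
    d / y = ε ⟨ y ↦ d ⟩

    field
      []ᵗ-cong : ∀ {X Y} .{{_ : NonEmpty (Var X)}} {a b : Term X} {σ τ : Subst X Y} →
                 a ≈ᵗ b → σ ≗ˢ τ → a [ σ ]ᵗ ≈ᵗ b [ τ ]ᵗ
      []ᶠ-cong : ∀ {X Y} .{{_ : NonEmpty (Var X)}} {p q : Formula X} {σ τ : Subst X Y} →
                 p ≈ᶠ q → σ ≗ˢ τ → p [ σ ]ᶠ ≈ᶠ q [ τ ]ᶠ
      all-cong : ∀ {X} (x : Var X) {p q : Formula X} → p ≈ᶠ q → all x p ≈ᶠ all x q

      P1ᵗ : ∀ {X} .{{_ : NonEmpty (Var X)}} (a : Term X) → a [ ε ]ᵗ ≈ᵗ a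
      P1ᶠ : ∀ {X} .{{_ : NonEmpty (Var X)}} (p : Formula X) → p [ ε ]ᶠ ≈ᶠ p
      P2ᵗ : ∀ {X Y W} .{{_ : NonEmpty (Var X)}} .{{_ : NonEmpty (Var Y)}}
            (a : Term X) (σ : Subst X Y) (τ : Subst Y W) →
            a [ σ ]ᵗ [ τ ]ᵗ ≈ᵗ a [ σ ⊙ τ ]ᵗ
      P2ᶠ : ∀ {X Y W} .{{_ : NonEmpty (Var X)}} .{{_ : NonEmpty (Var Y)}}
            (p : Formula X) (σ : Subst X Y) (τ : Subst Y W) →
            p [ σ ]ᶠ [ τ ]ᶠ ≈ᶠ p [ σ ⊙ τ ]ᶠ
      P3  : ∀ {X Y} .{{_ : NonEmpty (Var X)}} (x : Var X) (σ : Subst X Y) →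
            ε {X} x [ σ ]ᵗ ≈ᵗ σ x
      P4  : ∀ {X Y} .{{_ : NonEmpty (Var X)}} (σ : Subst X Y) →
            IsBooleanHomomorphism (formulas X) (formulas Y) (_[ σ ]ᶠ)
      P5  : ∀ {X Y} .{{_ : NonEmpty (Var X)}} .{{_ : NonEmpty (Var Y)}}
            (x : Var X) (p : Formula X) (σ : Subst X Y) (y z : Var Y) →
            y ≢ z → σ ⊙ (ε z / y) ≗ˢ σ →
            all x p [ σ ]ᶠ ≈ᶠ all y (p [ σ ⟨ x ↦ ε y ⟩ ]ᶠ)
      Q1  : ∀ {X} (x : Var X) (p q : Formula X) → all x (p ∧ q) ≈ᶠ all x p ∧ all x q
      Q2  : ∀ {X} (x : Var X) (p : Formula X) → all x p ≤ p
      Q3  : ∀ {X} .{{_ : NonEmpty (Var X)}} (x : Var X) (p : Formula X) (y : Var X) →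
            y ≢ x → p [ ε y / x ]ᶠ ≈ᶠ p → all x p ≈ᶠ p

  module _ {s : Level} {S : Pred (Set ℓ) s} (A : QuantifierTheory S) where
    open QuantifierTheory A

    module _ {u : Level} {X : Member S} .{{_ : NonEmpty (Var X)}} (V : Pred (Var X) u) where

      IsSupportᵗ : Term X → Set (suc ℓ ⊔ s ⊔ u)
      IsSupportᵗ a = ∀ {Y} (σ τ : Subst X Y) → (∀ x → V x → σ x ≈ᵗ τ x) → a [ σ ]ᵗ ≈ᵗ a [ τ ]ᵗ

      IsSupportᶠ : Formula X → Set (suc ℓ ⊔ s ⊔ u)
      IsSupportᶠ p = ∀ {Y} (σ τ : Subst X Y) → (∀ x → V x → σ x ≈ᵗ τ x) → p [ σ ]ᶠ ≈ᶠ p [ τ ]ᶠ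

    Closedᶠ : ∀ {X} .{{_ : NonEmpty (Var X)}} → Formula X → Set (suc ℓ ⊔ s)
    Closedᶠ = IsSupportᶠ ∅

    -- Over the empty set of variables everything is closed, hence the
    -- restriction to nonempty X in the following two definitions.

    Nontrivial : Set (suc ℓ ⊔ s)
    Nontrivial = Σ[ X ∈ Member S ] Σ[ ne ∈ NonEmpty (Var X) ] Σ[ p ∈ Formula X ]
                 ¬ Closedᶠ {{ne}} p

    record LocallyFinite : Set (suc ℓ ⊔ s) where
      field
        term-support    : ∀ {X} .{{_ : NonEmpty (Var X)}} (a : Term X) →
                          Σ[ V ∈ Pred (Var X) ℓ ] (Finite V × IsSupportᵗ V a)
        formula-support : ∀ {X} .{{_ : NonEmpty (Var X)}} (p : Formula X) →
                          Σ[ V ∈ Pred (Var X) ℓ ] (Finite V × IsSupportᶠ V p)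

  GlobalTheory : Set (suc ℓ)
  GlobalTheory = QuantifierTheory U

  restrict : ∀ {s t} {S : Pred (Set ℓ) s} {T : Pred (Set ℓ) t} →
             S ⊆ T → QuantifierTheory T → QuantifierTheory S
  restrict S⊆T A = record
    { terms    = terms ∘ refine S⊆T
    ; formulas = formulas ∘ refine S⊆T
    ; ε        = ε
    ; _[_]ᵗ    = _[_]ᵗ
    ; _[_]ᶠ    = _[_]ᶠ
    ; all      = all
    ; []ᵗ-cong = []ᵗ-cong
    ; []ᶠ-cong = []ᶠ-cong
    ; all-cong = all-cong
    ; P1ᵗ      = P1ᵗ
    ; P1ᶠ      = P1ᶠ
    ; P2ᵗ      = P2ᵗ
    ; P2ᶠ      = P2ᶠ
    ; P3       = P3
    ; P4       = P4
    ; P5       = P5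
    ; Q1       = Q1
    ; Q2       = Q2
    ; Q3       = Q3
    }
    where open QuantifierTheory A

  infix 4 _≅_ _≋_

  record _≅_ {s : Level} {S : Pred (Set ℓ) s} (A B : QuantifierTheory S) : Set (suc ℓ ⊔ s) where
    private
      module A = QuantifierTheory A
      module B = QuantifierTheory B
    field
      term-bijection    : ∀ X → Bijection (A.terms X) (B.terms X)
      formula-bijection : ∀ X → Bijection (BooleanAlgebra.setoid (A.formulas X))
                                          (BooleanAlgebra.setoid (B.formulas X))

    toᵗ : ∀ {X} → A.Term X → B.Term X
    toᵗ {X} = Bijection.to (term-bijection X)

    toᶠ : ∀ {X} → A.Formula X → B.Formula X
    toᶠ {X} = Bijection.to (formula-bijection X)

    field
      toᶠ-homo : ∀ X → IsBooleanHomomorphism (A.formulas X) (B.formulas X) toᶠ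
      ε-homo   : ∀ {X} (x : Var X) → toᵗ (A.ε {X} x) B.≈ᵗ B.ε x
      []ᵗ-homo : ∀ {X Y} .{{_ : NonEmpty (Var X)}} (a : A.Term X) (σ : A.Subst X Y) →
                 toᵗ (a A.[ σ ]ᵗ) B.≈ᵗ toᵗ a B.[ toᵗ ∘ σ ]ᵗ
      []ᶠ-homo : ∀ {X Y} .{{_ : NonEmpty (Var X)}} (p : A.Formula X) (σ : A.Subst X Y) →
                 toᶠ (p A.[ σ ]ᶠ) B.≈ᶠ toᶠ p B.[ toᵗ ∘ σ ]ᶠ
      all-homo : ∀ {X} (x : Var X) (p : A.Formula X) → toᶠ (A.all x p) B.≈ᶠ B.all x (toᶠ p)

  -- Equality of theories: the carriers are the same types, and under this
  -- identification the equivalence relations and operations agree.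

  record _≋_ {s : Level} {S : Pred (Set ℓ) s} (A B : QuantifierTheory S) : Set (suc ℓ ⊔ s) where
    private
      module A = QuantifierTheory A
      module B = QuantifierTheory B
    field
      isomorphism : A ≅ B
    open _≅_ isomorphism using (toᵗ; toᶠ)
    field
      Term-≡     : ∀ X → A.Term X ≡ B.Term X
      Formula-≡  : ∀ X → A.Formula X ≡ B.Formula X
      toᵗ-coerce : ∀ {X} (a : A.Term X) → toᵗ a ≡ subst id (Term-≡ X) a
      toᶠ-coerce : ∀ {X} (p : A.Formula X) → toᶠ p ≡ subst id (Formula-≡ X) p

  record IsQuantifierModel {t : Level} {T : Pred (Set ℓ) t} (∅∈T : T ⊥)
                           (B : QuantifierTheory T) : Set (suc ℓ ⊔ t) where
    open QuantifierTheory B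

    ∅ₘ : Member T
    ∅ₘ = ⊥ , [ ∅∈T ]

    field
      M1ᵗ : NonEmpty (Term ∅ₘ)
      M1ᶠ : ¬ (BooleanAlgebra.⊥ (formulas ∅ₘ) ≈ᶠ BooleanAlgebra.⊤ (formulas ∅ₘ))
      M2  : ∀ {X} .{{_ : NonEmpty (Var X)}} (x : Var X) (p : Formula X) (σ : Subst X ∅ₘ) →
            IsInfimum (order (formulas ∅ₘ))
                      (λ (d : Term ∅ₘ) → p [ σ ⟨ x ↦ d ⟩ ]ᶠ) (all x p [ σ ]ᶠ)

  record IsModel {s : Level} {S : Pred (Set ℓ) s}
                 (A : QuantifierTheory S) (B : QuantifierTheory (S ∪∅)) : Set (suc ℓ ⊔ s) where
    field
      isQuantifierModel : IsQuantifierModel (inj₂ refl) B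
      restriction-≋     : restrict {S = S ∖∅} (λ (X∈S , _) → inj₁ X∈S) B ≋
                          restrict {S = S ∖∅} (λ (X∈S , _) → X∈S) A

{-# OPTIONS --safe #-}
module Submission where

-- Fix an infinite I in S.  By local finiteness an element a over a nonempty X in S
-- is determined by the map ρ ↦ a ρ from substitutions X → A*(I) to A(I), which is finitely
-- supported and commutes with substitutions I → A*(I); conversely every such map
-- comes from a unique a, since a finite part of X embeds into I.  These maps make
-- sense for an arbitrary set Z and form A′(Z).  Substitution is composition, the
-- Boolean operations are pointwise, and (∀z.φ)(ρ) = ∀y.φ(ρ^{y/z}) for any y in I
-- that is fresh for the finitely many relevant values of ρ.  The choice of y is
-- immaterial: by (P5), all but finitely many y' give the same value as y.

open import Defs
open import Algebra.Lattice.Bundles using (BooleanAlgebra)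
open import Algebra.Lattice.Morphism.Structures using (module LatticeMorphisms)
open import Axiom.ExcludedMiddle using (ExcludedMiddle)
open import Data.Empty using (⊥-elim-irr)
open import Data.Irrelevant using () renaming ([_] to irr)
open import Data.List.Base using (List; []; _∷_; _++_; map; concatMap)
open import Data.List.Membership.Propositional using (_∈_; _∉_; lose)
open import Data.List.Membership.Propositional.Properties
  using (∈-++⁺ˡ; ∈-++⁺ʳ; ∈-map⁺; ∈-map⁻; ∈-concatMap⁺)
open import Data.List.Relation.Unary.Any using (here; there)
open import Data.Product.Base using (Σ-syntax; _×_; _,_; proj₁; proj₂)
open import Data.Refinement using (_,_; value; refine)
open import Data.Sum.Base using (inj₁; map₁)
open import Data.Unit.Base using (tt)
open import Function.Base using (id; _∘_)
open import Function.Bundles using (Equivalence; mk⇔; Bijection)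
open import Level using (Level; _⊔_; suc)
open import Relation.Binary.Bundles using (Setoid)
open import Relation.Binary.PropositionalEquality.Core using (_≡_; _≢_; refl; sym; trans; cong; subst)
import Function.Construct.Identity as Identity
import Relation.Binary.Reasoning.Setoid as SetoidReasoning
open import Relation.Nullary using (¬_; Dec; yes; no; contradiction; recompute)
open import Relation.Unary using (Pred; U)

module Classical (em : ∀ {a} → ExcludedMiddle a) where

  -- Fresh elements, updated maps and embeddings of finite parts.

  dec : ∀ {a} (P : Set a) → Dec P
  dec P = em

  -- An irrelevant proof of nonemptiness yields no element directly; deciding `X` by excluded middle
  -- recovers one.
  inhabitant : ∀ {a} {X : Set a} .{{_ : NonEmpty X}} → X
  inhabitant {X = X} {{ne}} = recompute (dec X) (NonEmpty.witness ne)

  -- A list that missed no element would enumerate `X` and make it finite.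
  fresh : ∀ {a} {X : Set a} → Infinite X → (L : List X) → Σ[ x ∈ X ] x ∉ L
  fresh {X = X} inf L with dec (Σ[ x ∈ X ] x ∉ L)
  ... | yes found = found
  ... | no ¬found = contradiction (L , λ x → mk⇔ (λ _ → covered x) (λ _ → _)) inf
    where
    covered : ∀ x → x ∈ L
    covered x with dec (x ∈ L)
    ... | yes x∈L = x∈L
    ... | no  x∉L = contradiction (x , x∉L) ¬found

  module _ {ℓ : Level} where
    open Theory {ℓ} em

    ⟨⟩-elim : ∀ {b p} {X : Set ℓ} {B : Set b} (P : B → Set p) (σ : X → B) (x : X) (d : B) (z : X) →
              (z ≡ x → P d) → (z ≢ x → P (σ z)) → P ((σ ⟨ x ↦ d ⟩) z)
    ⟨⟩-elim P σ x d z hit miss with dec (z ≡ x)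
    ... | yes z≡x = hit z≡x
    ... | no  z≢x = miss z≢x

    ⟨⟩-hit : ∀ {b} {X : Set ℓ} {B : Set b} (σ : X → B) (x : X) (d : B) → (σ ⟨ x ↦ d ⟩) x ≡ d
    ⟨⟩-hit σ x d = ⟨⟩-elim (_≡ d) σ x d x (λ _ → refl) (contradiction refl)

    ⟨⟩-miss : ∀ {b} {X : Set ℓ} {B : Set b} (σ : X → B) (x : X) (d : B) {z : X} →
              z ≢ x → (σ ⟨ x ↦ d ⟩) z ≡ σ z
    ⟨⟩-miss σ x d {z} z≢x = ⟨⟩-elim (_≡ σ z) σ x d z (λ z≡x → contradiction z≡x z≢x) (λ _ → refl)

    ⟨⟩-rel : ∀ {b c r} {X : Set ℓ} {B : Set b} {C : Set c} (R : B → C → Set r)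
             (σ : X → B) (τ : X → C) (x : X) {d : B} {e : C} (z : X) →
             R d e → (z ≢ x → R (σ z) (τ z)) → R ((σ ⟨ x ↦ d ⟩) z) ((τ ⟨ x ↦ e ⟩) z)
    ⟨⟩-rel R σ τ x z hit miss with dec (z ≡ x)
    ... | yes z≡x = hit
    ... | no  z≢x = miss z≢x

    -- Cutting a substitution off outside a finite list leaves its effect on elements supported by
    -- the list unchanged, but makes it take only finitely many values.
    on_use_or_ : ∀ {b} {X : Set ℓ} {B : Set b} → List X → (X → B) → B → X → B
    (on L use σ or d) x with dec (x ∈ L)
    ... | yes _ = σ x
    ... | no  _ = d

    on-∈ : ∀ {b} {X : Set ℓ} {B : Set b} {L : List X} (σ : X → B) (d : B) {x : X} →
           x ∈ L → (on L use σ or d) x ≡ σ x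
    on-∈ {L = L} σ d {x} x∈L with dec (x ∈ L)
    ... | yes _   = refl
    ... | no  x∉L = contradiction x∈L x∉L

    on-elim : ∀ {b p} {X : Set ℓ} {B : Set b} (P : B → Set p) (L : List X) (σ : X → B) (d : B) (x : X) →
              (x ∈ L → P (σ x)) → (x ∉ L → P d) → P ((on L use σ or d) x)
    on-elim P L σ d x hit miss with dec (x ∈ L)
    ... | yes x∈L = hit x∈L
    ... | no  x∉L = miss x∉L

    -- An embedding of a finite part of `Z` into `X`. Both maps are total, so that `ε ∘ into` and
    -- `σ ∘ back` are substitutions; their values elsewhere are arbitrary.
    record Retraction (X : Set ℓ) {Z : Set ℓ} (L : List Z) : Set ℓ where
      field
        into    : Z → X
        back    : X → Z
        inverse : ∀ {z} → z ∈ L → back (into z) ≡ z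

    -- Induction on the list. A new `z` is sent to some `x` outside the image of the list so far, so
    -- redefining `back` at `x` does not disturb the earlier inverses.
    retraction : ∀ {X Z : Set ℓ} → Infinite X → Z → (L : List Z) → Retraction X L
    retraction inf z₀ [] = record
      { into    = λ _ → proj₁ (fresh inf [])
      ; back    = λ _ → z₀
      ; inverse = λ ()
      }
    retraction {X} inf z₀ (z ∷ L) with dec (z ∈ L) | retraction {X} inf z₀ L
    ... | yes z∈L | R = record
      { into    = into
      ; back    = back
      ; inverse = λ { (here refl) → inverse z∈L ; (there v∈L) → inverse v∈L }
      }
      where open Retraction R
    ... | no z∉L | R = record
      { into    = into ⟨ z ↦ x ⟩
      ; back    = back ⟨ x ↦ z ⟩
      ; inverse = λ
        { (here refl) → trans (cong (back ⟨ x ↦ z ⟩) (⟨⟩-hit into z x)) (⟨⟩-hit back x z)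
        ; (there {x = _} v∈L) →
            trans (cong (back ⟨ x ↦ z ⟩) (⟨⟩-miss into z x (λ { refl → z∉L v∈L })))
                  (trans (⟨⟩-miss back x z (λ eq → x∉ (subst (_∈ map into L) eq (∈-map⁺ into v∈L))))
                         (inverse v∈L))
        }
      }
      where
      open Retraction R
      x   = proj₁ (fresh inf (map into L))
      x∉  = proj₂ (fresh inf (map into L))

  -- Terms and formulas as substitution actions with finite supports.

  module Globalize {ℓ s : Level} {S : Pred (Set ℓ) s} (infinite : HasInfiniteMember S)
                   (A : Theory.QuantifierTheory {ℓ} em S) (lf : Theory.LocallyFinite {ℓ} em A) where
    open Theory {ℓ} em
    open QuantifierTheory A

    I : Member S
    I = proj₁ infinite , irr (proj₁ (proj₂ infinite))

    I-infinite : Infinite (Var I)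
    I-infinite = proj₂ (proj₂ infinite)

    freshᴵ : (L : List (Var I)) → Σ[ i ∈ Var I ] i ∉ L
    freshᴵ = fresh I-infinite

    i₀ : Var I
    i₀ = proj₁ (freshᴵ [])

    instance
      I-nonEmpty : NonEmpty (Var I)
      I-nonEmpty = nonEmpty i₀

    module T {X : Member S} = Setoid (terms X)
    module F {X : Member S} = BooleanAlgebra (formulas X)

    -- Common ground for terms and formulas, so that arguments about supports and substitution are
    -- made once. The list `vars a` supports `a` for every target, not only for `I`.
    record Action : Set (suc ℓ ⊔ s) where
      infix 8 _[_]
      field
        setoid : Member S → Setoid ℓ ℓ
      module C {X : Member S} = Setoid (setoid X)
      field
        _[_]     : ∀ {X Y} .{{_ : NonEmpty (Var X)}} → C.Carrier {X} → Subst X Y → C.Carrier {Y}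
        []-cong  : ∀ {X Y} .{{_ : NonEmpty (Var X)}} {a b : C.Carrier {X}} {σ τ : Subst X Y} →
                   a C.≈ b → σ ≗ˢ τ → a [ σ ] C.≈ b [ τ ]
        []-ε     : ∀ {X} .{{_ : NonEmpty (Var X)}} (a : C.Carrier {X}) → a [ ε ] C.≈ a
        []-⊙     : ∀ {X Y W} .{{_ : NonEmpty (Var X)}} .{{_ : NonEmpty (Var Y)}}
                   (a : C.Carrier {X}) (σ : Subst X Y) (τ : Subst Y W) →
                   a [ σ ] [ τ ] C.≈ a [ σ ⊙ τ ]
        vars     : ∀ {X} .{{_ : NonEmpty (Var X)}} → C.Carrier {X} → List (Var X)
        vars-support : ∀ {X Y} .{{_ : NonEmpty (Var X)}} (a : C.Carrier {X}) (σ τ : Subst X Y) →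
                   (∀ {x} → x ∈ vars a → σ x ≈ᵗ τ x) → a [ σ ] C.≈ a [ τ ]

    open LocallyFinite lf

    termAction : Action
    termAction = record
      { setoid       = terms
      ; _[_]         = _[_]ᵗ
      ; []-cong      = []ᵗ-cong
      ; []-ε         = P1ᵗ
      ; []-⊙         = P2ᵗ
      ; vars         = λ a → proj₁ (proj₁ (proj₂ (term-support a)))
      ; vars-support = λ a σ τ agree → let V , (L , V⇔L) , support = term-support a in
                       support σ τ (λ x Vx → agree (Equivalence.to (V⇔L x) Vx))
      }

    formulaAction : Action
    formulaAction = record
      { setoid       = λ X → BooleanAlgebra.setoid (formulas X)
      ; _[_]         = _[_]ᶠ
      ; []-cong      = []ᶠ-cong
      ; []-ε         = P1ᶠ
      ; []-⊙         = P2ᶠ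
      ; vars         = λ p → proj₁ (proj₁ (proj₂ (formula-support p)))
      ; vars-support = λ p σ τ agree → let V , (L , V⇔L) , support = formula-support p in
                       support σ τ (λ x Vx → agree (Equivalence.to (V⇔L x) Vx))
      }

    open Action termAction using () renaming (vars to varsᵗ; vars-support to varsᵗ-support)
    open Action formulaAction using () renaming (vars to varsᶠ; vars-support to varsᶠ-support)

    -- Finitely supported natural operations.

    -- An element over an arbitrary set Z is represented by the values it takes
    -- under all substitutions of terms over the infinite set I for Z.
    record Op (K : Action) (Z : Set ℓ) : Set ℓ where
      open Action K
      field
        eval    : (Z → Term I) → C.Carrier {I}
        supp    : List Z
        support : ∀ {ρ μ : Z → Term I} → (∀ {z} → z ∈ supp → ρ z ≈ᵗ μ z) → eval ρ C.≈ eval μ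
        natural : ∀ (ρ : Z → Term I) (τ : Subst I I) → eval ρ [ τ ] C.≈ eval (ρ ⊙ τ)

    open Op

    opSetoid : Action → Set ℓ → Setoid ℓ ℓ
    opSetoid K Z = record
      { Carrier       = Op K Z
      ; _≈_           = λ φ ψ → ∀ ρ → eval φ ρ C.≈ eval ψ ρ
      ; isEquivalence = record
        { refl  = λ ρ → C.refl
        ; sym   = λ φ≈ψ ρ → C.sym (φ≈ψ ρ)
        ; trans = λ φ≈ψ ψ≈χ ρ → C.trans (φ≈ψ ρ) (ψ≈χ ρ)
        }
      }
      where open Action K

    var : ∀ {Z} → Z → Op termAction Z
    var z = record
      { eval    = λ ρ → ρ z
      ; supp    = z ∷ []
      ; support = λ agree → agree (here refl)
      ; natural = λ ρ τ → T.refl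
      }

    -- Extension of operations to substitutions into any member of `S`.

    module _ {K : Action} where
      open Action K

      -- L is a support of t only for substitutions into I, whereas vars t is a
      -- support for all targets: a variable outside both lists mediates.
      support-transfer : ∀ (t : C.Carrier {I}) (L : List (Var I)) →
        (∀ (ρ μ : Subst I I) → (∀ {i} → i ∈ L → ρ i ≈ᵗ μ i) → t [ ρ ] C.≈ t [ μ ]) →
        ∀ {Y} (σ τ : Subst I Y) → (∀ {i} → i ∈ L → σ i ≈ᵗ τ i) → t [ σ ] C.≈ t [ τ ]
      support-transfer t L L-support {Y} σ τ agree = begin
        t [ σ ]                     ≈⟨ outside σ (σ i₀) ⟩
        t [ on L use σ or σ i₀ ]    ≈⟨ []-cong C.refl patched ⟩
        t [ on L use τ or σ i₀ ]    ≈⟨ outside τ (σ i₀) ⟨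
        t [ τ ]                     ∎
        where
        open SetoidReasoning (setoid Y)
        k∉ = proj₂ (freshᴵ (vars t ++ L))
        k  = proj₁ (freshᴵ (vars t ++ L))
        patched : (on L use σ or σ i₀) ≗ˢ (on L use τ or σ i₀)
        patched i with dec (i ∈ L)
        ... | yes i∈L = agree i∈L
        ... | no  _   = T.refl
        -- As `k` is not in `vars t`, `ν` may be changed at `k`. As `L` supports `t` into `I`, all
        -- variables off `L` may first be renamed to `k`, and are then sent to `d`.
        outside : ∀ (ν : Subst I Y) d → t [ ν ] C.≈ t [ on L use ν or d ]
        outside ν d = begin
          t [ ν ]                                     ≈⟨ vars-support t _ _ (λ i∈ →
                                                          T.reflexive (sym (⟨⟩-miss ν k d λ { refl → k∉ (∈-++⁺ˡ i∈) }))) ⟩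
          t [ ν ⟨ k ↦ d ⟩ ]                           ≈⟨ []-cong ([]-ε t) (λ _ → T.refl) ⟨
          t [ ε ] [ ν ⟨ k ↦ d ⟩ ]                     ≈⟨ []-cong (L-support _ _ λ i∈ →
                                                          T.reflexive (sym (on-∈ ε (ε k) i∈))) (λ _ → T.refl) ⟩
          t [ on L use ε or ε k ] [ ν ⟨ k ↦ d ⟩ ]     ≈⟨ []-⊙ t _ _ ⟩
          t [ (on L use ε or ε k) ⊙ (ν ⟨ k ↦ d ⟩) ]   ≈⟨ []-cong C.refl merged ⟩
          t [ on L use ν or d ]                       ∎
          where
          merged : (on L use ε or ε k) ⊙ (ν ⟨ k ↦ d ⟩) ≗ˢ (on L use ν or d)
          merged i with dec (i ∈ L)
          ... | yes i∈L = T.trans (P3 i _) (T.reflexive (⟨⟩-miss ν k d λ { refl → k∉ (∈-++⁺ʳ (vars t) i∈L) }))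
          ... | no  _   = T.trans (P3 k _) (T.reflexive (⟨⟩-hit ν k d))

      module _ {Z : Set ℓ} where

        -- Naturality along `ρ ∘ back`: the single element `eval φ (ε ∘ into)` over `I` encodes the
        -- whole operation.
        via-retraction : ∀ (φ : Op K Z) {L} (R : Retraction (Var I) L) → (∀ {z} → z ∈ supp φ → z ∈ L) →
          ∀ ρ → let open Retraction R in eval φ ρ C.≈ eval φ (ε ∘ into) [ ρ ∘ back ]
        via-retraction φ R ⊆L ρ = C.sym (C.trans (natural φ _ _) (support φ λ {z} z∈ →
          T.trans (P3 (into z) _) (T.reflexive (cong ρ (inverse (⊆L z∈))))))
          where open Retraction R

        -- The fields of `Op` speak only of substitutions into `I`. For a general target `Y`, both
        -- sides are written as substitution instances of the encoding element `t`, to which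
        -- `support-transfer` applies.
        eval-[] : ∀ .{{_ : NonEmpty Z}} (φ : Op K Z) {Y} (ρ μ : Z → Term I) (σ τ : Subst I Y) →
          (∀ {z} → z ∈ supp φ → ρ z [ σ ]ᵗ ≈ᵗ μ z [ τ ]ᵗ) → eval φ ρ [ σ ] C.≈ eval φ μ [ τ ]
        eval-[] φ {Y} ρ μ σ τ agree = begin
          eval φ ρ [ σ ]                 ≈⟨ []-cong (via-retraction φ R id ρ) (λ _ → T.refl) ⟩
          t [ ρ ∘ back ] [ σ ]           ≈⟨ []-⊙ t _ _ ⟩
          t [ (ρ ∘ back) ⊙ σ ]           ≈⟨ support-transfer t (map into (supp φ)) t-support _ _ agree′ ⟩
          t [ (μ ∘ back) ⊙ τ ]           ≈⟨ []-⊙ t _ _ ⟨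
          t [ μ ∘ back ] [ τ ]           ≈⟨ []-cong (via-retraction φ R id μ) (λ _ → T.refl) ⟨
          eval φ μ [ τ ]                 ∎
          where
          open SetoidReasoning (setoid Y)
          R = retraction I-infinite inhabitant (supp φ)
          open Retraction R
          t = eval φ (ε ∘ into)
          t-support : ∀ (α β : Subst I I) → (∀ {i} → i ∈ map into (supp φ) → α i ≈ᵗ β i) → t [ α ] C.≈ t [ β ]
          t-support α β eq = C.trans (natural φ _ α) (C.trans (support φ λ {z} z∈ →
            T.trans (P3 (into z) α) (T.trans (eq (∈-map⁺ into z∈)) (T.sym (P3 (into z) β)))) (C.sym (natural φ _ β)))
          agree′ : ∀ {i} → i ∈ map into (supp φ) → ρ (back i) [ σ ]ᵗ ≈ᵗ μ (back i) [ τ ]ᵗ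
          agree′ i∈ with ∈-map⁻ into i∈
          ... | z , z∈ , refl = T.trans ([]ᵗ-cong (T.reflexive (cong ρ (inverse z∈))) (λ _ → T.refl))
            (T.trans (agree z∈) ([]ᵗ-cong (T.reflexive (cong μ (sym (inverse z∈)))) (λ _ → T.refl)))

        infix 8 _⟪_⟫

        _⟪_⟫ : Op K Z → ∀ {W} → (Z → Op termAction W) → Op K W
        φ ⟪ σ ⟫ = record
          { eval    = λ ρ → eval φ (λ z → eval (σ z) ρ)
          ; supp    = concatMap (supp ∘ σ) (supp φ)
          ; support = λ agree → support φ λ {z} z∈ → support (σ z) λ w∈ →
                      agree (∈-concatMap⁺ (supp ∘ σ) (lose z∈ w∈))
          ; natural = λ ρ τ → C.trans (natural φ _ τ) (support φ λ {z} _ → natural (σ z) ρ τ)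
          }

        -- The value of `φ` at a substitution into any member `Y`, obtained by factoring through
        -- `I`. It supplies both the substitutions into empty members of `S` and the inverse of
        -- `denote`.
        extend : .{{_ : NonEmpty Z}} → Op K Z → ∀ {Y} → (Z → Term Y) → C.Carrier {Y}
        extend φ σ = eval φ (ε ∘ into) [ σ ∘ back ]
          where open Retraction (retraction I-infinite inhabitant (supp φ))

        -- The definition of `extend` uses one particular factorization of `σ` through `I`; by
        -- `eval-[]`, any other one valid on `supp φ` gives the same value.
        extend-unique : ∀ .{{_ : NonEmpty Z}} (φ : Op K Z) {Y} (ρ : Z → Term I) (τ : Subst I Y) (σ : Z → Term Y) →
          (∀ {z} → z ∈ supp φ → ρ z [ τ ]ᵗ ≈ᵗ σ z) → eval φ ρ [ τ ] C.≈ extend φ σ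
        extend-unique φ ρ τ σ agree = eval-[] φ ρ _ τ _ λ {z} z∈ →
          T.trans (agree z∈) (T.sym (T.trans (P3 (into z) _) (T.reflexive (cong σ (inverse z∈)))))
          where open Retraction (retraction I-infinite inhabitant (supp φ))

        extend-support : ∀ .{{_ : NonEmpty Z}} (φ : Op K Z) {Y} (σ τ : Z → Term Y) →
          (∀ {z} → z ∈ supp φ → σ z ≈ᵗ τ z) → extend φ σ C.≈ extend φ τ
        extend-support φ σ τ agree = extend-unique φ _ _ τ λ {z} z∈ →
          T.trans (P3 (into z) _) (T.trans (T.reflexive (cong σ (inverse z∈))) (agree z∈))
          where open Retraction (retraction I-infinite inhabitant (supp φ))

        extend-via : ∀ .{{_ : NonEmpty Z}} (φ : Op K Z) {L} (R : Retraction (Var I) L) → (∀ {z} → z ∈ supp φ → z ∈ L) →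
          ∀ {Y} (σ : Z → Term Y) → let open Retraction R in extend φ σ C.≈ eval φ (ε ∘ into) [ σ ∘ back ]
        extend-via φ R ⊆L σ = C.sym (extend-unique φ _ _ σ λ {z} z∈ →
          T.trans (P3 (into z) _) (T.reflexive (cong σ (inverse (⊆L z∈)))))
          where open Retraction R

        -- Equal operations may carry different support lists and hence use different retractions,
        -- so both extensions are recomputed with one retraction for the joint list.
        extend-cong : ∀ .{{_ : NonEmpty Z}} {φ ψ : Op K Z} {Y} {σ τ : Z → Term Y} →
          (∀ ρ → eval φ ρ C.≈ eval ψ ρ) → σ ≗ˢ τ → extend φ σ C.≈ extend ψ τ
        extend-cong {φ} {ψ} {Y} {σ} {τ} φ≈ψ σ≗τ =
          C.trans (extend-via φ R ∈-++⁺ˡ σ)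
          (C.trans ([]-cong (φ≈ψ _) (λ _ → σ≗τ _)) (C.sym (extend-via ψ R (∈-++⁺ʳ (supp φ)) τ)))
          where R = retraction I-infinite inhabitant (supp φ ++ supp ψ)

    -- The retraction for the support of the composite also retracts the support of each `σ z` with
    -- `z` in `supp φ`, so `extend-unique` applies to `φ` and then to each such `σ z`.
    extend-⟪⟫ : ∀ (K : Action) {Z W : Set ℓ} .{{_ : NonEmpty Z}} .{{_ : NonEmpty W}} (φ : Op K Z)
      (σ : Z → Op termAction W) {Y} (τ : W → Term Y) →
      Action.C._≈_ K (extend (φ ⟪ σ ⟫) τ) (extend φ (λ z → extend (σ z) τ))
    extend-⟪⟫ K φ σ τ = extend-unique φ _ _ _ λ {z} z∈ →
      extend-unique (σ z) _ _ τ λ {w} w∈ →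
      T.trans (P3 (into w) _) (T.reflexive (cong τ (inverse (∈-concatMap⁺ (supp ∘ σ) (lose z∈ w∈)))))
      where open Retraction (retraction I-infinite inhabitant (supp (φ ⟪ σ ⟫)))

    extend-var : ∀ {Z : Set ℓ} .{{_ : NonEmpty Z}} (z : Z) {Y} (σ : Z → Term Y) →
      extend (var z) σ ≈ᵗ σ z
    extend-var z σ = T.trans (P3 (into z) _) (T.reflexive (cong σ (inverse (here refl))))
      where open Retraction (retraction I-infinite inhabitant (z ∷ []))

    -- The Boolean algebra of operations.

    Op₀ : Set ℓ → Set ℓ
    Op₀ = Op formulaAction

    module H (X Y : Member S) .{{_ : NonEmpty (Var X)}} (σ : Subst X Y) where
      open IsBooleanHomomorphism (P4 {X} {Y} σ) public
      open LatticeMorphisms.IsLatticeHomomorphism isLatticeHomomorphism public using (∨-homo; ∧-homo)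

    constant : ∀ {Z} (c : Formula I) → (∀ (σ : Subst I I) → c [ σ ]ᶠ ≈ᶠ c) → Op₀ Z
    constant c homo = record
      { eval = λ _ → c ; supp = [] ; support = λ _ → F.refl ; natural = λ _ τ → homo τ }

    lift₁ : ∀ {Z} (f : Formula I → Formula I) → (∀ {p q} → p ≈ᶠ q → f p ≈ᶠ f q) →
      (∀ (σ : Subst I I) p → f p [ σ ]ᶠ ≈ᶠ f (p [ σ ]ᶠ)) → Op₀ Z → Op₀ Z
    lift₁ f f-cong homo φ = record
      { eval    = λ ρ → f (eval φ ρ)
      ; supp    = supp φ
      ; support = λ agree → f-cong (support φ agree)
      ; natural = λ ρ τ → F.trans (homo τ _) (f-cong (natural φ ρ τ))
      }

    lift₂ : ∀ {Z} (f : Formula I → Formula I → Formula I) →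
      (∀ {p q r s} → p ≈ᶠ q → r ≈ᶠ s → f p r ≈ᶠ f q s) →
      (∀ (σ : Subst I I) p q → f p q [ σ ]ᶠ ≈ᶠ f (p [ σ ]ᶠ) (q [ σ ]ᶠ)) → Op₀ Z → Op₀ Z → Op₀ Z
    lift₂ f f-cong homo φ ψ = record
      { eval    = λ ρ → f (eval φ ρ) (eval ψ ρ)
      ; supp    = supp φ ++ supp ψ
      ; support = λ agree → f-cong (support φ (agree ∘ ∈-++⁺ˡ)) (support ψ (agree ∘ ∈-++⁺ʳ (supp φ)))
      ; natural = λ ρ τ → F.trans (homo τ _ _) (f-cong (natural φ ρ τ) (natural ψ ρ τ))
      }

    opAlgebra : Set ℓ → BooleanAlgebra ℓ ℓ
    opAlgebra Z = record
      { Carrier = Op₀ Z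
      ; _≈_     = Setoid._≈_ (opSetoid formulaAction Z)
      ; _∨_     = lift₂ F._∨_ F.∨-cong (λ τ → H.∨-homo I I τ)
      ; _∧_     = lift₂ F._∧_ F.∧-cong (λ τ → H.∧-homo I I τ)
      ; ¬_      = lift₁ F.¬_ F.¬-cong (λ τ → H.¬-homo I I τ)
      ; ⊤       = constant F.⊤ (λ τ → H.⊤-homo I I τ)
      ; ⊥       = constant F.⊥ (λ τ → H.⊥-homo I I τ)
      ; isBooleanAlgebra = record
        { isDistributiveLattice = record
          { isLattice = record
            { isEquivalence = Setoid.isEquivalence (opSetoid formulaAction Z)
            ; ∨-comm     = λ φ ψ ρ → F.∨-comm _ _
            ; ∨-assoc    = λ φ ψ χ ρ → F.∨-assoc _ _ _
            ; ∨-cong     = λ φ≈ ψ≈ ρ → F.∨-cong (φ≈ ρ) (ψ≈ ρ)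
            ; ∧-comm     = λ φ ψ ρ → F.∧-comm _ _
            ; ∧-assoc    = λ φ ψ χ ρ → F.∧-assoc _ _ _
            ; ∧-cong     = λ φ≈ ψ≈ ρ → F.∧-cong (φ≈ ρ) (ψ≈ ρ)
            ; absorptive = (λ φ ψ ρ → F.∨-absorbs-∧ _ _) , (λ φ ψ ρ → F.∧-absorbs-∨ _ _)
            }
          ; ∨-distrib-∧ = (λ φ ψ χ ρ → F.∨-distribˡ-∧ _ _ _) , (λ φ ψ χ ρ → F.∨-distribʳ-∧ _ _ _)
          ; ∧-distrib-∨ = (λ φ ψ χ ρ → F.∧-distribˡ-∨ _ _ _) , (λ φ ψ χ ρ → F.∧-distribʳ-∨ _ _ _)
          }
        ; ∨-complement = (λ φ ρ → F.∨-complementˡ _) , (λ φ ρ → F.∨-complementʳ _)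
        ; ∧-complement = (λ φ ρ → F.∧-complementˡ _) , (λ φ ρ → F.∧-complementʳ _)
        ; ¬-cong       = λ φ≈ ρ → F.¬-cong (φ≈ ρ)
        }
      }

    -- Quantification with fresh bound variables.

    Cofinitely : Pred (Var I) ℓ → Set ℓ
    Cofinitely P = Σ[ L ∈ List (Var I) ] (∀ {i} → i ∉ L → P i)

    both : ∀ {P Q} → Cofinitely P → Cofinitely Q → Cofinitely (λ i → P i × Q i)
    both (L , p) (M , q) = L ++ M , λ i∉ → p (i∉ ∘ ∈-++⁺ˡ) , q (i∉ ∘ ∈-++⁺ʳ L)

    -- Infinitude of `I` lets two cofinite conditions hold at once. Quantified formulas are compared
    -- by rewriting both with a common bound variable found in this way.
    meet : ∀ {P Q} → Cofinitely P → Cofinitely Q → Σ[ i ∈ Var I ] (P i × Q i)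
    meet p q = let L , r = both p q ; i , i∉ = freshᴵ L in i , r i∉

    varsOn : ∀ {Z : Set ℓ} → List Z → (Z → Term I) → List (Var I)
    varsOn L ρ = concatMap (varsᵗ ∘ ρ) L

    ∈-varsOn : ∀ {Z : Set ℓ} {L : List Z} {ρ : Z → Term I} {z i} → z ∈ L → i ∈ varsᵗ (ρ z) → i ∈ varsOn L ρ
    ∈-varsOn {ρ = ρ} z∈ i∈ = ∈-concatMap⁺ (varsᵗ ∘ ρ) (lose z∈ i∈)

    /-stable : ∀ (a : Term I) {i d} → i ∉ varsᵗ a → a [ d / i ]ᵗ ≈ᵗ a
    /-stable a {i} {d} i∉ = T.trans
      (varsᵗ-support a _ _ λ j∈ → T.reflexive (⟨⟩-miss ε i d λ { refl → i∉ j∈ })) (P1ᵗ a)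

    -- P5 needs a variable that occurs in no value of τ, so τ is first made
    -- constant off a finite set of variables.
    all-[] : ∀ {X : Member S} .{{_ : NonEmpty (Var X)}} (x : Var X) (p : Formula X) (τ : Subst X I) →
      Cofinitely λ i → all x p [ τ ]ᶠ ≈ᶠ all i (p [ τ ⟨ x ↦ ε i ⟩ ]ᶠ)
    -- `i₀` is both the default value of `τ′` and the second variable that `P5` asks for, so `i` has
    -- to differ from it.
    all-[] {X} x p τ = (i₀ ∷ varsOn L τ) , λ {i} i∉ → begin
      all x p [ τ ]ᶠ                     ≈⟨ varsᶠ-support (all x p) _ _ (λ y∈ → τ≈τ′ (∈-++⁺ˡ y∈)) ⟩
      all x p [ τ′ ]ᶠ                    ≈⟨ P5 x p τ′ i i₀ (λ { refl → i∉ (here refl) }) (avoids i∉) ⟩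
      all i (p [ τ′ ⟨ x ↦ ε i ⟩ ]ᶠ)      ≈⟨ all-cong i (varsᶠ-support p _ _ λ {y} y∈ →
                                             ⟨⟩-rel _≈ᵗ_ τ′ τ x y T.refl
                                               (λ _ → T.sym (τ≈τ′ (∈-++⁺ʳ (varsᶠ (all x p)) y∈)))) ⟩
      all i (p [ τ ⟨ x ↦ ε i ⟩ ]ᶠ)       ∎
      where
      open SetoidReasoning (BooleanAlgebra.setoid (formulas I))
      L = varsᶠ (all x p) ++ varsᶠ p
      τ′ : Subst X I
      τ′ = on L use τ or ε i₀
      τ≈τ′ : ∀ {y} → y ∈ L → τ y ≈ᵗ τ′ y
      τ≈τ′ y∈ = T.reflexive (sym (on-∈ τ (ε i₀) y∈))
      avoids : ∀ {i} → i ∉ i₀ ∷ varsOn L τ → τ′ ⊙ (ε i₀ / i) ≗ˢ τ′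
      avoids {i} i∉ y = on-elim (λ a → a [ ε i₀ / i ]ᵗ ≈ᵗ a) L τ (ε i₀) y
        (λ y∈ → /-stable (τ y) (i∉ ∘ there ∘ ∈-varsOn y∈))
        (λ _ → T.trans (P3 i₀ _) (T.reflexive (⟨⟩-miss ε i (ε i₀) λ { refl → i∉ (here refl) })))

    module _ {Z : Set ℓ} (z : Z) (φ : Op₀ Z) where

      -- The candidate value with bound variable `i`. It is the intended one when `i` does not occur
      -- in the values of `ρ` on `supp φ`; otherwise variables may be captured.
      instanceAt : (Z → Term I) → Var I → Formula I
      instanceAt ρ i = all i (eval φ (ρ ⟨ z ↦ ε i ⟩))

      instanceAt-support : ∀ {ρ μ} i → (∀ {v} → v ∈ supp φ → ρ v ≈ᵗ μ v) → instanceAt ρ i ≈ᶠ instanceAt μ i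
      instanceAt-support {ρ} {μ} i agree = all-cong i (support φ λ {v} v∈ →
        ⟨⟩-rel _≈ᵗ_ ρ μ z v T.refl (λ _ → agree v∈))

      -- By `all-[]` the bound `y` can be renamed to almost any `i`. Since `y` is fresh,
      -- `τ ⟨ y ↦ ε i ⟩` acts on the relevant values of `ρ` as `τ` does. The case of `ε` gives
      -- independence of the bound variable, the general case naturality.
      instanceAt-[] : ∀ {ρ μ y} (τ : Subst I I) → y ∉ varsOn (supp φ) ρ → (∀ {v} → v ∈ supp φ → ρ v [ τ ]ᵗ ≈ᵗ μ v) →
        Cofinitely λ i → instanceAt ρ y [ τ ]ᶠ ≈ᶠ instanceAt μ i
      instanceAt-[] {ρ} {μ} {y} τ y∉ ρτ≈μ = let L , renamed = all-[] y (eval φ (ρ ⟨ z ↦ ε y ⟩)) τ in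
        L , λ {i} i∉ → F.trans (renamed i∉)
          (all-cong i (F.trans (natural φ _ _) (support φ λ {v} v∈ →
            ⟨⟩-rel (λ a b → a [ τ ⟨ y ↦ ε i ⟩ ]ᵗ ≈ᵗ b) ρ μ z v
              (T.trans (P3 y _) (T.reflexive (⟨⟩-hit τ y (ε i))))
              (λ _ → T.trans
                (varsᵗ-support (ρ v) _ _ λ {j} j∈ → T.reflexive (⟨⟩-miss τ y (ε i) λ { refl → y∉ (∈-varsOn v∈ j∈) }))
                (ρτ≈μ v∈)))))

      -- Freshness is required only on `supp φ`, because all the values of `ρ` together may involve
      -- infinitely many variables.
      universal : (Z → Term I) → Formula I
      universal ρ = instanceAt ρ (proj₁ (freshᴵ (varsOn (supp φ) ρ)))

      universal-[] : ∀ {ρ μ} (τ : Subst I I) → (∀ {v} → v ∈ supp φ → ρ v [ τ ]ᵗ ≈ᵗ μ v) →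
        Cofinitely λ i → universal ρ [ τ ]ᶠ ≈ᶠ instanceAt μ i
      universal-[] {ρ} τ = instanceAt-[] τ (proj₂ (freshᴵ (varsOn (supp φ) ρ)))

      universal-value : ∀ ρ → Cofinitely λ i → universal ρ ≈ᶠ instanceAt ρ i
      universal-value ρ = let L , value = universal-[] ε (λ {v} _ → P1ᵗ (ρ v)) in
        L , λ i∉ → F.trans (F.sym (P1ᶠ _)) (value i∉)

      quantify : Op₀ Z
      quantify = record
        { eval    = universal
        ; supp    = supp φ
        -- The values at `ρ` and `μ` may have been computed with different fresh variables.
        ; support = λ {ρ} {μ} agree →
            let i , ρ-value , μ-value = meet (universal-value ρ) (universal-value μ) in
            F.trans ρ-value (F.trans (instanceAt-support i agree) (F.sym μ-value))
        ; natural = λ ρ τ →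
            let i , ρ-value , ρτ-value = meet (universal-[] τ (λ _ → T.refl)) (universal-value (ρ ⊙ τ)) in
            F.trans ρ-value (F.sym ρτ-value)
        }

    quantify-cong : ∀ {Z : Set ℓ} (z : Z) {φ ψ : Op₀ Z} → (∀ ρ → eval φ ρ ≈ᶠ eval ψ ρ) →
      ∀ ρ → eval (quantify z φ) ρ ≈ᶠ eval (quantify z ψ) ρ
    quantify-cong z {φ} {ψ} φ≈ψ ρ =
      let i , φ-value , ψ-value = meet (universal-value z φ ρ) (universal-value z ψ ρ) in
      F.trans φ-value (F.trans (all-cong i (φ≈ψ _)) (F.sym ψ-value))

    -- With a common bound variable `i`, both sides evaluate `φ` at `ε i` for `z`; they can differ
    -- only by the effect on `σ v` of changing `ρ` at `y`, which `ignores` excludes.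
    quantify-⟪⟫ : ∀ {Z W : Set ℓ} (z : Z) (φ : Op₀ Z) (σ : Z → Op termAction W) (y w : W) → y ≢ w →
      (∀ v ρ → eval (σ v ⟪ var ⟨ y ↦ var w ⟩ ⟫) ρ ≈ᵗ eval (σ v) ρ) →
      ∀ ρ → eval (quantify z φ ⟪ σ ⟫) ρ ≈ᶠ
            eval (quantify y (φ ⟪ σ ⟨ z ↦ var y ⟩ ⟫)) ρ
    quantify-⟪⟫ {Z} {W} z φ σ y w y≢w σ-avoids ρ =
      let i , lhs , rhs = meet (universal-value z φ (λ v → eval (σ v) ρ))
                               (universal-value y (φ ⟪ σ ⟨ z ↦ var y ⟩ ⟫) ρ) in
      F.trans lhs (F.trans (all-cong i (support φ λ {v} _ → merged i v)) (F.sym rhs))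
      where
      -- By `σ-avoids`, `σ v` may be evaluated with `ρ w` in place of `ρ y`, and `ρ w` is unaffected
      -- by a change at `y`, as `w` differs from `y`.
      ignores : ∀ v d → eval (σ v) ρ ≈ᵗ eval (σ v) (ρ ⟨ y ↦ d ⟩)
      ignores v d = T.trans (T.sym (σ-avoids v ρ)) (T.trans (support (σ v) (λ {u} _ → same u))
        (σ-avoids v (ρ ⟨ y ↦ d ⟩)))
        where
        same : ∀ u → eval ((var ⟨ y ↦ var w ⟩) u) ρ ≈ᵗ eval ((var ⟨ y ↦ var w ⟩) u) (ρ ⟨ y ↦ d ⟩)
        same u = ⟨⟩-elim (λ a → eval a ρ ≈ᵗ eval a (ρ ⟨ y ↦ d ⟩)) var y (var w) u
          (λ _ → T.reflexive (sym (⟨⟩-miss ρ y d (λ { refl → y≢w refl }))))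
          (λ u≢y → T.reflexive (sym (⟨⟩-miss ρ y d u≢y)))
      merged : ∀ i v → ((λ u → eval (σ u) ρ) ⟨ z ↦ ε i ⟩) v ≈ᵗ eval ((σ ⟨ z ↦ var y ⟩) v) (ρ ⟨ y ↦ ε i ⟩)
      merged i v = ⟨⟩-rel (λ a b → a ≈ᵗ eval b (ρ ⟨ y ↦ ε i ⟩)) (λ u → eval (σ u) ρ) σ z v
        (T.reflexive (sym (⟨⟩-hit ρ y (ε i)))) (λ _ → ignores v (ε i))

    quantify-∧ : ∀ {Z : Set ℓ} (z : Z) (φ ψ : Op₀ Z) → let _⊓_ = BooleanAlgebra._∧_ (opAlgebra Z) in
      ∀ ρ → eval (quantify z (φ ⊓ ψ)) ρ ≈ᶠ eval (quantify z φ ⊓ quantify z ψ) ρ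
    quantify-∧ {Z} z φ ψ ρ =
      let i , ∧-value , φ-value , ψ-value =
            meet (universal-value z (φ ⊓ ψ) ρ) (both (universal-value z φ ρ) (universal-value z ψ ρ))
      in F.trans ∧-value (F.trans (Q1 i _ _) (F.sym (F.∧-cong φ-value ψ-value)))
      where open BooleanAlgebra (opAlgebra Z) using () renaming (_∧_ to _⊓_)

    -- For fresh `i`, `Q2` bounds the quantified formula by its body `r`. Substituting `ρ z` for `i`
    -- turns `r` into `eval φ ρ` and fixes the quantified side, whose values do not involve `i`.
    quantify-≤ : ∀ {Z : Set ℓ} (z : Z) (φ : Op₀ Z) → ∀ ρ → eval (quantify z φ) ρ ≤ eval φ ρ
    quantify-≤ z φ ρ =
      let i , value , i∉ = meet (universal-value z φ ρ) (varsOn (supp φ) ρ , id)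
          stable = λ {v} (v∈ : v ∈ supp φ) → /-stable (ρ v) {i} {ρ z} (i∉ ∘ ∈-varsOn v∈)
          r = eval φ (ρ ⟨ z ↦ ε i ⟩)
          undo : r [ ρ z / i ]ᶠ ≈ᶠ eval φ ρ
          undo = F.trans (natural φ _ _) (support φ λ {v} v∈ →
            ⟨⟩-elim (λ a → a [ ρ z / i ]ᵗ ≈ᵗ ρ v) ρ z (ε i) v
              (λ { refl → T.trans (P3 i _) (T.reflexive (⟨⟩-hit ε i (ρ z))) }) (λ _ → stable v∈))
          u≈ : universal z φ ρ [ ρ z / i ]ᶠ ≈ᶠ universal z φ ρ
          u≈ = F.trans (natural (quantify z φ) ρ _) (support (quantify z φ) stable)
          open SetoidReasoning (BooleanAlgebra.setoid (formulas I))
      in begin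
        universal z φ ρ                                   ≈⟨ u≈ ⟨
        universal z φ ρ [ ρ z / i ]ᶠ                      ≈⟨ []ᶠ-cong (F.trans value (Q2 i r)) (λ _ → T.refl) ⟩
        (all i r ∧ r) [ ρ z / i ]ᶠ                        ≈⟨ H.∧-homo I I _ _ _ ⟩
        all i r [ ρ z / i ]ᶠ ∧ r [ ρ z / i ]ᶠ             ≈⟨ F.∧-cong (F.trans ([]ᶠ-cong (F.sym value) (λ _ → T.refl)) u≈) undo ⟩
        universal z φ ρ ∧ eval φ ρ                        ∎

    -- The hypothesis makes `φ` independent of the value at `z`, so the body is `eval φ ρ` itself.
    -- With `i` outside its variables, `Q3` over `I` removes the quantifier.
    quantify-fixed : ∀ {Z : Set ℓ} (z : Z) (φ : Op₀ Z) (y : Z) → y ≢ z →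
      (∀ ρ → eval (φ ⟪ var ⟨ z ↦ var y ⟩ ⟫) ρ ≈ᶠ eval φ ρ) →
      ∀ ρ → eval (quantify z φ) ρ ≈ᶠ eval φ ρ
    quantify-fixed z φ y y≢z φ-avoids ρ =
      let i , value , i∉ = meet (universal-value z φ ρ) (varsᶠ (eval φ ρ) , id)
          j , j∉ = freshᴵ (i ∷ [])
      in F.trans value (F.trans (all-cong i (F.sym (ignores (ε i))))
         (Q3 i (eval φ ρ) j (j∉ ∘ here)
             (F.trans (varsᶠ-support (eval φ ρ) _ _ λ k∈ → T.reflexive (⟨⟩-miss ε i (ε j) λ { refl → i∉ k∈ }))
                      (P1ᶠ _))))
      where
      ignores : ∀ d → eval φ ρ ≈ᶠ eval φ (ρ ⟨ z ↦ d ⟩)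
      ignores d = F.trans (F.sym (φ-avoids ρ)) (F.trans (support φ λ {v} _ → same v) (φ-avoids (ρ ⟨ z ↦ d ⟩)))
        where
        same : ∀ v → eval ((var ⟨ z ↦ var y ⟩) v) ρ ≈ᵗ eval ((var ⟨ z ↦ var y ⟩) v) (ρ ⟨ z ↦ d ⟩)
        same v = ⟨⟩-elim (λ a → eval a ρ ≈ᵗ eval a (ρ ⟨ z ↦ d ⟩)) var z (var y) v
          (λ _ → T.reflexive (sym (⟨⟩-miss ρ z d y≢z)))
          (λ v≢z → T.reflexive (sym (⟨⟩-miss ρ z d v≢z)))

    -- Elements over nonempty members of `S` as operations.

    module _ (K : Action) (X : Member S) .{{_ : NonEmpty (Var X)}} where
      open Action K

      denote : C.Carrier {X} → Op K (Var X)
      denote a = record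
        { eval    = λ ρ → a [ ρ ]
        ; supp    = vars a
        ; support = λ agree → vars-support a _ _ agree
        ; natural = λ ρ τ → []-⊙ a ρ τ
        }

      extend-denote : ∀ a {Y} (σ : Subst X Y) → extend (denote a) σ C.≈ a [ σ ]
      extend-denote a σ = C.trans ([]-⊙ a _ _) (vars-support a _ _ λ {x} x∈ →
        T.trans (P3 (into x) _) (T.reflexive (cong σ (inverse x∈))))
        where open Retraction (retraction I-infinite inhabitant (vars a))

      -- Surjectivity of `denote`: renaming the encoding element over `I` back into `X` by
      -- `ε ∘ back` gives a preimage of `φ`.
      denote-extend : ∀ (φ : Op K (Var X)) ρ → extend φ ε [ ρ ] C.≈ eval φ ρ
      denote-extend φ ρ = C.trans ([]-⊙ {Y = X} _ _ ρ) (C.trans ([]-cong C.refl (λ i → P3 (back i) ρ))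
        (C.sym (via-retraction φ R id ρ)))
        where
        R = retraction I-infinite inhabitant (supp φ)
        open Retraction R

      -- Injectivity holds because `extend` depends only on values over `I`, and at `ε` it returns
      -- the original element.
      denote-bijection : Bijection (setoid X) (opSetoid K (Var X))
      denote-bijection = record
        { to        = denote
        ; cong      = λ a≈b ρ → []-cong a≈b (λ _ → T.refl)
        ; bijective =
            (λ {a} {b} a≈b → C.trans (C.sym (roundtrip a))
              (C.trans (extend-cong {φ = denote a} {ψ = denote b} {σ = ε} {τ = ε} a≈b (λ _ → T.refl)) (roundtrip b)))
          , (λ φ → extend φ ε , λ a≈ ρ → C.trans ([]-cong a≈ (λ _ → T.refl)) (denote-extend φ ρ))
        }
        where
        roundtrip : ∀ a → extend (denote a) ε C.≈ a
        roundtrip a = C.trans (extend-denote a ε) ([]-ε a)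

    denote-all : ∀ (X : Member S) .{{_ : NonEmpty (Var X)}} (x : Var X) (p : Formula X) → ∀ ρ →
      all x p [ ρ ]ᶠ ≈ᶠ eval (quantify x (denote formulaAction X p)) ρ
    denote-all X x p ρ =
      let i , lhs , rhs = meet (all-[] x p ρ) (universal-value x (denote formulaAction X p) ρ) in
      F.trans lhs (F.sym rhs)

    -- Substitutions as Boolean homomorphisms.

    module _ {Z : Set ℓ} .{{_ : NonEmpty Z}} where

      ⟪⟫-homo : ∀ {W} (σ : Z → Op termAction W) →
        IsBooleanHomomorphism (opAlgebra Z) (opAlgebra W) (_⟪ σ ⟫)
      ⟪⟫-homo σ = record
        { isLatticeHomomorphism = record
          { isRelHomomorphism = record { cong = λ φ≈ψ ρ → φ≈ψ _ }
          ; ∧-homo = λ φ ψ ρ → F.refl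
          ; ∨-homo = λ φ ψ ρ → F.refl
          }
        ; ¬-homo = λ φ ρ → F.refl
        ; ⊤-homo = λ ρ → F.refl
        ; ⊥-homo = λ ρ → F.refl
        }

      extend-homo : ∀ {Y} (σ : Z → Term Y) →
        IsBooleanHomomorphism (opAlgebra Z) (formulas Y) (λ φ → extend φ σ)
      extend-homo {Y} σ = record
        { isLatticeHomomorphism = record
          { isRelHomomorphism = record { cong = λ {φ} {ψ} φ≈ψ → extend-cong {φ = φ} {ψ = ψ} {σ = σ} {τ = σ} φ≈ψ (λ _ → T.refl) }
          ; ∧-homo = λ φ ψ → let R = retraction I-infinite inhabitant (supp φ ++ supp ψ) in
              F.trans (H.∧-homo I Y _ _ _)
                (F.sym (F.∧-cong (extend-via φ R ∈-++⁺ˡ σ) (extend-via ψ R (∈-++⁺ʳ (supp φ)) σ)))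
          ; ∨-homo = λ φ ψ → let R = retraction I-infinite inhabitant (supp φ ++ supp ψ) in
              F.trans (H.∨-homo I Y _ _ _)
                (F.sym (F.∨-cong (extend-via φ R ∈-++⁺ˡ σ) (extend-via ψ R (∈-++⁺ʳ (supp φ)) σ)))
          }
        ; ¬-homo = λ φ → H.¬-homo I Y _ _
        ; ⊤-homo = H.⊤-homo I Y _
        ; ⊥-homo = H.⊥-homo I Y _
        }

    -- Assembly of the global theory.

    -- The data of A on an empty member of S are not determined by the rest of A,
    -- so on those sets they are kept as they are.
    View : Set ℓ → Set (ℓ ⊔ s)
    View Z = Dec ((¬ Z) × S Z)

    absurd : ∀ {a} {B : Set a} {Z : Set ℓ} .{{_ : NonEmpty Z}} → ¬ Z → B
    absurd ¬z = contradiction inhabitant ¬z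

    terms′ : ∀ {Z} → View Z → Setoid ℓ ℓ
    terms′ {Z} (yes (_ , Z∈S)) = terms (Z , irr Z∈S)
    terms′ {Z} (no _)          = opSetoid termAction Z

    formulas′ : ∀ {Z} → View Z → BooleanAlgebra ℓ ℓ
    formulas′ {Z} (yes (_ , Z∈S)) = formulas (Z , irr Z∈S)
    formulas′ {Z} (no _)          = opAlgebra Z

    Term′ : ∀ {Z} → View Z → Set ℓ
    Term′ v = Setoid.Carrier (terms′ v)

    Formula′ : ∀ {Z} → View Z → Set ℓ
    Formula′ v = BooleanAlgebra.Carrier (formulas′ v)

    Eqᵗ : ∀ {Z} (v : View Z) → Term′ v → Term′ v → Set ℓ
    Eqᵗ v = Setoid._≈_ (terms′ v)

    Eqᶠ : ∀ {Z} (v : View Z) → Formula′ v → Formula′ v → Set ℓ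
    Eqᶠ v = BooleanAlgebra._≈_ (formulas′ v)

    var′ : ∀ {Z} (v : View Z) → Z → Term′ v
    var′ (yes (¬z , _)) z = contradiction z ¬z
    var′ (no _)         z = var z

    -- An empty source is excluded. In the mixed case the target is an empty member with its
    -- original data, so composition of operations is replaced by `extend`.
    substᵗ : ∀ {Z W} (v : View Z) (w : View W) .{{_ : NonEmpty Z}} → Term′ v → (Z → Term′ w) → Term′ w
    substᵗ (yes (¬z , _)) _       = absurd ¬z
    substᵗ (no _)         (yes _) a σ = extend a σ
    substᵗ (no _)         (no _)  a σ = a ⟪ σ ⟫

    substᶠ : ∀ {Z W} (v : View Z) (w : View W) .{{_ : NonEmpty Z}} → Formula′ v → (Z → Term′ w) → Formula′ w
    substᶠ (yes (¬z , _)) _       = absurd ¬z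
    substᶠ (no _)         (yes _) p σ = extend p σ
    substᶠ (no _)         (no _)  p σ = p ⟪ σ ⟫

    all′ : ∀ {Z} (v : View Z) → Z → Formula′ v → Formula′ v
    all′ (yes (¬z , _)) z = contradiction z ¬z
    all′ (no _)         z = quantify z

    substᵗ-cong : ∀ {Z W} (v : View Z) (w : View W) .{{_ : NonEmpty Z}} {a b : Term′ v} {σ τ : Z → Term′ w} →
      Eqᵗ v a b → (∀ z → Eqᵗ w (σ z) (τ z)) → Eqᵗ w (substᵗ v w a σ) (substᵗ v w b τ)
    substᵗ-cong (yes (¬z , _)) _ = absurd ¬z
    substᵗ-cong (no _) (yes _) {a} {b} a≈b σ≈τ = extend-cong {φ = a} {ψ = b} a≈b σ≈τ
    substᵗ-cong (no _) (no _) {a} {b} {σ} {τ} a≈b σ≈τ ρ =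
      T.trans (a≈b _) (support b λ {z} _ → σ≈τ z ρ)

    substᶠ-cong : ∀ {Z W} (v : View Z) (w : View W) .{{_ : NonEmpty Z}} {p q : Formula′ v} {σ τ : Z → Term′ w} →
      Eqᶠ v p q → (∀ z → Eqᵗ w (σ z) (τ z)) → Eqᶠ w (substᶠ v w p σ) (substᶠ v w q τ)
    substᶠ-cong (yes (¬z , _)) _ = absurd ¬z
    substᶠ-cong (no _) (yes _) {p} {q} p≈q σ≈τ = extend-cong {φ = p} {ψ = q} p≈q σ≈τ
    substᶠ-cong (no _) (no _) {p} {q} {σ} {τ} p≈q σ≈τ ρ =
      F.trans (p≈q _) (support q λ {z} _ → σ≈τ z ρ)

    all′-cong : ∀ {Z} (v : View Z) (z : Z) {p q : Formula′ v} → Eqᶠ v p q → Eqᶠ v (all′ v z p) (all′ v z q)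
    all′-cong (yes (¬z , _)) z         = contradiction z ¬z
    all′-cong (no _)         z {p} {q} = quantify-cong z {p} {q}

    P1ᵗ′ : ∀ {Z} (v : View Z) .{{_ : NonEmpty Z}} (a : Term′ v) → Eqᵗ v (substᵗ v v a (var′ v)) a
    P1ᵗ′ (yes (¬z , _)) = absurd ¬z
    P1ᵗ′ (no _) a ρ     = T.refl

    P1ᶠ′ : ∀ {Z} (v : View Z) .{{_ : NonEmpty Z}} (p : Formula′ v) → Eqᶠ v (substᶠ v v p (var′ v)) p
    P1ᶠ′ (yes (¬z , _)) = absurd ¬z
    P1ᶠ′ (no _) p ρ     = F.refl

    P2ᵗ′ : ∀ {Z Y W} (v : View Z) (y : View Y) (w : View W) .{{_ : NonEmpty Z}} .{{_ : NonEmpty Y}}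
      (a : Term′ v) (σ : Z → Term′ y) (τ : Y → Term′ w) →
      Eqᵗ w (substᵗ y w (substᵗ v y a σ) τ) (substᵗ v w a (λ z → substᵗ y w (σ z) τ))
    P2ᵗ′ (yes (¬z , _)) _ _ = absurd ¬z
    P2ᵗ′ (no _) (yes (¬y , _)) _ = absurd ¬y
    P2ᵗ′ (no _) (no _) (yes _) a σ τ = extend-⟪⟫ termAction a σ τ
    P2ᵗ′ (no _) (no _) (no _) a σ τ ρ = T.refl

    P2ᶠ′ : ∀ {Z Y W} (v : View Z) (y : View Y) (w : View W) .{{_ : NonEmpty Z}} .{{_ : NonEmpty Y}}
      (p : Formula′ v) (σ : Z → Term′ y) (τ : Y → Term′ w) →
      Eqᶠ w (substᶠ y w (substᶠ v y p σ) τ) (substᶠ v w p (λ z → substᵗ y w (σ z) τ))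
    P2ᶠ′ (yes (¬z , _)) _ _ = absurd ¬z
    P2ᶠ′ (no _) (yes (¬y , _)) _ = absurd ¬y
    P2ᶠ′ (no _) (no _) (yes _) p σ τ = extend-⟪⟫ formulaAction p σ τ
    P2ᶠ′ (no _) (no _) (no _) p σ τ ρ = F.refl

    P3′ : ∀ {Z W} (v : View Z) (w : View W) .{{_ : NonEmpty Z}} (z : Z) (σ : Z → Term′ w) →
      Eqᵗ w (substᵗ v w (var′ v z) σ) (σ z)
    P3′ (yes (¬z , _)) _       = absurd ¬z
    P3′ (no _)         (yes _) z σ = extend-var z σ
    P3′ (no _)         (no _)  z σ ρ = T.refl

    P4′ : ∀ {Z W} (v : View Z) (w : View W) .{{_ : NonEmpty Z}} (σ : Z → Term′ w) →
      IsBooleanHomomorphism (formulas′ v) (formulas′ w) (λ p → substᶠ v w p σ)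
    P4′ (yes (¬z , _)) _       = absurd ¬z
    P4′ (no _)         (yes _) σ = extend-homo σ
    P4′ (no _)         (no _)  σ = ⟪⟫-homo σ

    P5′ : ∀ {Z W} (v : View Z) (w : View W) .{{_ : NonEmpty Z}} .{{_ : NonEmpty W}}
      (z : Z) (p : Formula′ v) (σ : Z → Term′ w) (y u : W) → y ≢ u →
      (∀ x → Eqᵗ w (substᵗ w w (σ x) (var′ w ⟨ y ↦ var′ w u ⟩)) (σ x)) →
      Eqᶠ w (substᶠ v w (all′ v z p) σ) (all′ w y (substᶠ v w p (σ ⟨ z ↦ var′ w y ⟩)))
    P5′ (yes (¬z , _)) _              = absurd ¬z
    P5′ (no _)         (yes (¬w , _)) = absurd ¬w
    P5′ (no _)         (no _)         = quantify-⟪⟫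

    Q1′ : ∀ {Z} (v : View Z) (z : Z) (p q : Formula′ v) → let _⊓_ = BooleanAlgebra._∧_ (formulas′ v) in
      Eqᶠ v (all′ v z (p ⊓ q)) (all′ v z p ⊓ all′ v z q)
    Q1′ (yes (¬z , _)) z = contradiction z ¬z
    Q1′ (no _)         z = quantify-∧ z

    Q2′ : ∀ {Z} (v : View Z) (z : Z) (p : Formula′ v) → let _⊓_ = BooleanAlgebra._∧_ (formulas′ v) in
      Eqᶠ v (all′ v z p) (all′ v z p ⊓ p)
    Q2′ (yes (¬z , _)) z = contradiction z ¬z
    Q2′ (no _)         z = quantify-≤ z

    Q3′ : ∀ {Z} (v : View Z) .{{_ : NonEmpty Z}} (z : Z) (p : Formula′ v) (y : Z) → y ≢ z →
      Eqᶠ v (substᶠ v v p (var′ v ⟨ z ↦ var′ v y ⟩)) p → Eqᶠ v (all′ v z p) p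
    Q3′ (yes (¬z , _)) = absurd ¬z
    Q3′ (no _)         = quantify-fixed

    -- The operations and laws above take an arbitrary `View`, so that matching on it makes their
    -- types compute; the actual decision enters only here.
    view : (Z : Set ℓ) → View Z
    view Z = dec ((¬ Z) × S Z)

    globalization : GlobalTheory
    globalization = record
      { terms    = λ X → terms′ (view (value X))
      ; formulas = λ X → formulas′ (view (value X))
      ; ε        = λ {X} → var′ (view (value X))
      ; _[_]ᵗ    = λ {X} {Y} → substᵗ (view (value X)) (view (value Y))
      ; _[_]ᶠ    = λ {X} {Y} → substᶠ (view (value X)) (view (value Y))
      ; all      = λ {X} → all′ (view (value X))
      ; []ᵗ-cong = λ {X} {Y} → substᵗ-cong (view (value X)) (view (value Y))
      ; []ᶠ-cong = λ {X} {Y} → substᶠ-cong (view (value X)) (view (value Y))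
      ; all-cong = λ {X} → all′-cong (view (value X))
      ; P1ᵗ      = λ {X} → P1ᵗ′ (view (value X))
      ; P1ᶠ      = λ {X} → P1ᶠ′ (view (value X))
      ; P2ᵗ      = λ {X} {Y} {W} → P2ᵗ′ (view (value X)) (view (value Y)) (view (value W))
      ; P2ᶠ      = λ {X} {Y} {W} → P2ᶠ′ (view (value X)) (view (value Y)) (view (value W))
      ; P3       = λ {X} {Y} → P3′ (view (value X)) (view (value Y))
      ; P4       = λ {X} {Y} → P4′ (view (value X)) (view (value Y))
      ; P5       = λ {X} {Y} → P5′ (view (value X)) (view (value Y))
      ; Q1       = λ {X} → Q1′ (view (value X))
      ; Q2       = λ {X} → Q2′ (view (value X))
      ; Q3       = λ {X} → Q3′ (view (value X))
      }

    term-supp : ∀ {Z} (v : View Z) .{{_ : NonEmpty Z}} (a : Term′ v) →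
      Σ[ L ∈ List Z ] (∀ {W} (w : View W) (σ τ : Z → Term′ w) → (∀ {z} → z ∈ L → Eqᵗ w (σ z) (τ z)) →
                       Eqᵗ w (substᵗ v w a σ) (substᵗ v w a τ))
    term-supp (yes (¬z , _)) = absurd ¬z
    term-supp (no _) a = supp a , λ where
      (yes _) σ τ agree   → extend-support a σ τ agree
      (no _)  σ τ agree ρ → support a λ z∈ → agree z∈ ρ

    formula-supp : ∀ {Z} (v : View Z) .{{_ : NonEmpty Z}} (p : Formula′ v) →
      Σ[ L ∈ List Z ] (∀ {W} (w : View W) (σ τ : Z → Term′ w) → (∀ {z} → z ∈ L → Eqᵗ w (σ z) (τ z)) →
                       Eqᶠ w (substᶠ v w p σ) (substᶠ v w p τ))
    formula-supp (yes (¬z , _)) = absurd ¬z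
    formula-supp (no _) p = supp p , λ where
      (yes _) σ τ agree   → extend-support p σ τ agree
      (no _)  σ τ agree ρ → support p λ z∈ → agree z∈ ρ

    globalization-locallyFinite : LocallyFinite globalization
    globalization-locallyFinite = record
      { term-support = λ {X} a →
          let L , L-support = term-supp (view (value X)) a in
          (_∈ L) , (L , λ _ → mk⇔ id id) , λ {Y} σ τ agree → L-support (view (value Y)) σ τ (agree _)
      ; formula-support = λ {X} p →
          let L , L-support = formula-supp (view (value X)) p in
          (_∈ L) , (L , λ _ → mk⇔ id id) , λ {Y} σ τ agree → L-support (view (value Y)) σ τ (agree _)
      }

    -- The isomorphism of `A` with the restriction of the global theory.

    member-nonEmpty : (X : Member S) → ¬ ((¬ Var X) × S (Var X)) → NonEmpty (Var X)
    member-nonEmpty (Z , irr Z∈S) ¬empty with dec Z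
    ... | yes z = nonEmpty z
    -- `Z∈S` is irrelevant, so it may only feed a contradiction that is itself used irrelevantly.
    ... | no ¬z = ⊥-elim-irr (¬empty (¬z , Z∈S))

    term-iso : (X : Member S) (v : View (Var X)) → Bijection (terms X) (terms′ v)
    -- Irrelevance of membership proofs makes the retained setoid definitionally that of `A` at `X`.
    term-iso X (yes _)     = Identity.bijection (terms X)
    term-iso X (no ¬empty) = denote-bijection termAction X {{member-nonEmpty X ¬empty}}

    formula-iso : (X : Member S) (v : View (Var X)) →
      Bijection (BooleanAlgebra.setoid (formulas X)) (BooleanAlgebra.setoid (formulas′ v))
    formula-iso X (yes _)     = Identity.bijection (BooleanAlgebra.setoid (formulas X))
    formula-iso X (no ¬empty) = denote-bijection formulaAction X {{member-nonEmpty X ¬empty}}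

    formula-iso-homo : (X : Member S) (v : View (Var X)) →
      IsBooleanHomomorphism (formulas X) (formulas′ v) (Bijection.to (formula-iso X v))
    formula-iso-homo X (yes _) = record
      { isLatticeHomomorphism = record
        { isRelHomomorphism = record { cong = id }
        ; ∧-homo = λ _ _ → F.refl
        ; ∨-homo = λ _ _ → F.refl
        }
      ; ¬-homo = λ _ → F.refl
      ; ⊤-homo = F.refl
      ; ⊥-homo = F.refl
      }
    formula-iso-homo X (no ¬empty) = record
      { isLatticeHomomorphism = record
        { isRelHomomorphism = record { cong = Bijection.cong (formula-iso X (no ¬empty)) }
        ; ∧-homo = λ p q ρ → H.∧-homo X I {{ne}} ρ p q
        ; ∨-homo = λ p q ρ → H.∨-homo X I {{ne}} ρ p q
        }
      ; ¬-homo = λ p ρ → H.¬-homo X I {{ne}} ρ p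
      ; ⊤-homo = λ ρ → H.⊤-homo X I {{ne}} ρ
      ; ⊥-homo = λ ρ → H.⊥-homo X I {{ne}} ρ
      }
      where ne = member-nonEmpty X ¬empty

    var-iso : (X : Member S) (v : View (Var X)) (x : Var X) →
      Eqᵗ v (Bijection.to (term-iso X v) (ε x)) (var′ v x)
    var-iso X (yes (¬x , _)) x   = contradiction x ¬x
    var-iso X (no ¬empty)    x ρ = P3 {{member-nonEmpty X ¬empty}} x ρ

    substᵗ-iso : (X Y : Member S) (v : View (Var X)) (w : View (Var Y)) .{{_ : NonEmpty (Var X)}}
      (a : Term X) (σ : Subst X Y) →
      Eqᵗ w (Bijection.to (term-iso Y w) (a [ σ ]ᵗ))
            (substᵗ v w (Bijection.to (term-iso X v) a) (Bijection.to (term-iso Y w) ∘ σ))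
    substᵗ-iso X Y (yes (¬x , _)) _ = absurd ¬x
    substᵗ-iso X Y (no _) (yes _) a σ = T.sym (extend-denote termAction X a σ)
    substᵗ-iso X Y (no _) (no ¬empty) a σ ρ = P2ᵗ {{_}} {{member-nonEmpty Y ¬empty}} a σ ρ

    substᶠ-iso : (X Y : Member S) (v : View (Var X)) (w : View (Var Y)) .{{_ : NonEmpty (Var X)}}
      (p : Formula X) (σ : Subst X Y) →
      Eqᶠ w (Bijection.to (formula-iso Y w) (p [ σ ]ᶠ))
            (substᶠ v w (Bijection.to (formula-iso X v) p) (Bijection.to (term-iso Y w) ∘ σ))
    substᶠ-iso X Y (yes (¬x , _)) _ = absurd ¬x
    substᶠ-iso X Y (no _) (yes _) p σ = F.sym (extend-denote formulaAction X p σ)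
    substᶠ-iso X Y (no _) (no ¬empty) p σ ρ = P2ᶠ {{_}} {{member-nonEmpty Y ¬empty}} p σ ρ

    all-iso : (X : Member S) (v : View (Var X)) (x : Var X) (p : Formula X) →
      Eqᶠ v (Bijection.to (formula-iso X v) (all x p)) (all′ v x (Bijection.to (formula-iso X v) p))
    all-iso X (yes (¬x , _)) x   = contradiction x ¬x
    all-iso X (no ¬empty)    x p = denote-all X {{member-nonEmpty X ¬empty}} x p

    globalization-restricts : A ≅ restrict (λ _ → tt) globalization
    globalization-restricts = record
      { term-bijection    = λ X → term-iso X (view (value X))
      ; formula-bijection = λ X → formula-iso X (view (value X))
      ; toᶠ-homo          = λ X → formula-iso-homo X (view (value X))
      ; ε-homo            = λ {X} → var-iso X (view (value X))
      ; []ᵗ-homo          = λ {X} {Y} → substᵗ-iso X Y (view (value X)) (view (value Y))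
      ; []ᶠ-homo          = λ {X} {Y} → substᶠ-iso X Y (view (value X)) (view (value Y))
      ; all-homo          = λ {X} → all-iso X (view (value X))
      }

  -- Nontriviality and restriction of models.

  module _ {ℓ : Level} where
    open Theory {ℓ} em

    -- Closedness of `toᶠ p` over all targets includes those in `S`, and there injectivity of the
    -- isomorphism reflects it to `p`.
    nontrivial-extension : ∀ {s} {S : Pred (Set ℓ) s} (A : QuantifierTheory S) (A′ : GlobalTheory) →
      A ≅ restrict (λ _ → tt) A′ → Nontrivial A → Nontrivial A′
    nontrivial-extension A A′ iso (X , ne , p , ¬closed) =
      refine (λ _ → tt) X , ne , toᶠ p , λ closed → ¬closed λ {Y} σ τ _ →
        Bijection.injective (formula-bijection Y)
          (F′.trans Y ([]ᶠ-homo {{ne}} p σ)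
            (F′.trans Y (closed {refine (λ _ → tt) Y} (toᵗ ∘ σ) (toᵗ ∘ τ) (λ _ ()))
              (F′.sym Y ([]ᶠ-homo {{ne}} p τ))))
      where
      open _≅_ iso
      module F′ (Y : Member _) = BooleanAlgebra (QuantifierTheory.formulas A′ (refine (λ _ → tt) Y))

    module _ {s} {S : Pred (Set ℓ) s} (A : QuantifierTheory S) where
      open QuantifierTheory A

      -- Substituting two distinct variables of I for all the variables of p
      -- decides closedness, also for targets that are empty.
      closed-of : ∀ (I : Member S) (i j : Var I) →
        i ≢ j → ∀ {X} .{{_ : NonEmpty (Var X)}} (p : Formula X) →
        (∀ {Y} .{{_ : NonEmpty (Var Y)}} (σ τ : Subst X Y) → p [ σ ]ᶠ ≈ᶠ p [ τ ]ᶠ) → Closedᶠ A p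
      closed-of I i j i≢j {X} p same {Y} σ τ _ = begin
        p [ σ ]ᶠ                             ≈⟨ constantly σ ⟩
        p [ (λ _ → d) ]ᶠ                     ≈⟨ []ᶠ-cong F.refl (λ _ →
                                                 T.trans (P3 i ς) (T.reflexive (⟨⟩-hit (λ _ → e) i d))) ⟨
        p [ (λ _ → ε {I} i) ⊙ ς ]ᶠ               ≈⟨ P2ᶠ p (λ _ → ε i) ς ⟨
        p [ (λ _ → ε {I} i) ]ᶠ [ ς ]ᶠ            ≈⟨ []ᶠ-cong (same (λ _ → ε i) (λ _ → ε {I} j)) (λ _ → T.refl) ⟩
        p [ (λ _ → ε {I} j) ]ᶠ [ ς ]ᶠ            ≈⟨ P2ᶠ p (λ _ → ε j) ς ⟩
        p [ (λ _ → ε {I} j) ⊙ ς ]ᶠ               ≈⟨ []ᶠ-cong F.refl (λ _ →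
                                                 T.trans (P3 j ς) (T.reflexive (⟨⟩-miss (λ _ → e) i d (i≢j ∘ sym)))) ⟩
        p [ (λ _ → e) ]ᶠ                     ≈⟨ constantly τ ⟨
        p [ τ ]ᶠ                             ∎
        where
        module F {X : Member _} = BooleanAlgebra (formulas X)
        module T {X : Member _} = Setoid (terms X)
        open SetoidReasoning (BooleanAlgebra.setoid (formulas Y))
        instance
          I-nonEmpty : NonEmpty (Var I)
          I-nonEmpty = nonEmpty i
        x : Var X
        x = inhabitant
        d = σ x
        e = τ x
        ς : Subst I Y
        -- As `ς` sends `i` to `d` and `j` to `e`, both constant substitutions into `Y` factor
        -- through constants over the nonempty `I`, where `same` applies.
        ς = (λ _ → e) ⟨ i ↦ d ⟩
        constantly : ∀ (ν : Subst X Y) → p [ ν ]ᶠ ≈ᶠ p [ (λ _ → ν x) ]ᶠ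
        constantly ν = begin
          p [ ν ]ᶠ                     ≈⟨ []ᶠ-cong (P1ᶠ p) (λ _ → T.refl) ⟨
          p [ ε ]ᶠ [ ν ]ᶠ              ≈⟨ []ᶠ-cong (same ε (λ _ → ε x)) (λ _ → T.refl) ⟩
          p [ (λ _ → ε x) ]ᶠ [ ν ]ᶠ    ≈⟨ P2ᶠ p (λ _ → ε x) ν ⟩
          p [ (λ _ → ε x) ⊙ ν ]ᶠ       ≈⟨ []ᶠ-cong F.refl (λ _ → P3 x ν) ⟩
          p [ (λ _ → ν x) ]ᶠ           ∎

    module _ {s} (S : Pred (Set ℓ) s) (A′ : GlobalTheory) (B : QuantifierTheory (U ∪∅)) (model : IsModel A′ B) where
      open IsModel model
      open IsQuantifierModel isQuantifierModel
      open _≋_ restriction-≋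
      open _≅_ isomorphism

      at : Member (S ∖∅) → Member (U ∖∅)
      at = refine λ (_ , ne) → tt , ne

      -- Restriction to `S ∪∅` keeps the data at the empty set, and irrelevance of membership makes
      -- it the same member as before, so each model condition is an instance of the original one.
      model-restriction : IsModel (restrict {S = S} (λ _ → tt) A′) (restrict {S = S ∪∅} (map₁ (λ _ → tt)) B)
      model-restriction = record
        { isQuantifierModel = record { M1ᵗ = M1ᵗ ; M1ᶠ = M1ᶠ ; M2 = M2 }
        ; restriction-≋     = record
          { isomorphism = record
            { term-bijection    = term-bijection ∘ at
            ; formula-bijection = formula-bijection ∘ at
            ; toᶠ-homo          = toᶠ-homo ∘ at
            ; ε-homo            = ε-homo
            ; []ᵗ-homo          = []ᵗ-homo
            ; []ᶠ-homo          = []ᶠ-homo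
            ; all-homo          = all-homo
            }
          ; Term-≡     = Term-≡ ∘ at
          ; Formula-≡  = Formula-≡ ∘ at
          ; toᵗ-coerce = toᵗ-coerce
          ; toᶠ-coerce = toᶠ-coerce
          }
        }

      module A′ = QuantifierTheory A′
      module B = QuantifierTheory B

      nonempty : (X : Member S) .{{_ : NonEmpty (Var X)}} → Member (U ∖∅)
      nonempty (X , _) {{ne}} = X , irr (tt , ne)

      module _ {X : Member S} .{{_ : NonEmpty (Var X)}} (p : A′.Formula (refine (λ _ → tt) X)) where

        preimage : B.Formula (refine (λ _ → inj₁ tt) X)
        preimage = proj₁ (Bijection.surjective (formula-bijection (nonempty X)) p)

        toᶠ-preimage : toᶠ {nonempty X} preimage A′.≈ᶠ p
        toᶠ-preimage = proj₂ (Bijection.surjective (formula-bijection (nonempty X)) p)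
          (BooleanAlgebra.refl (B.formulas (refine (λ _ → inj₁ tt) X)))

        -- Terms over `Y` lift along the surjective comparison map. The model and `A′` are
        -- identified only over nonempty sets, so only nonempty targets are reached; empty ones are
        -- left to `closed-of`.
        preimage-same :
          (∀ {Y : Member S} (σ τ : Var X → B.Term (refine (λ _ → inj₁ tt) Y)) → preimage B.[ σ ]ᶠ B.≈ᶠ preimage B.[ τ ]ᶠ) →
          ∀ {Y : Member S} .{{_ : NonEmpty (Var Y)}} (σ τ : Var X → A′.Term (refine (λ _ → tt) Y)) →
          p A′.[ σ ]ᶠ A′.≈ᶠ p A′.[ τ ]ᶠ
        preimage-same same {Y} σ τ = F.trans (reflect σ)
          (F.trans (Bijection.cong (formula-bijection (nonempty Y)) (same {Y} (lift σ) (lift τ))) (F.sym (reflect τ)))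
          where
          module F = BooleanAlgebra (A′.formulas (refine (λ _ → tt) Y))
          onto = Bijection.surjective (term-bijection (nonempty Y))
          lift : (Var X → A′.Term (refine (λ _ → tt) Y)) → Var X → B.Term (refine (λ _ → inj₁ tt) Y)
          lift ν x = proj₁ (onto (ν x))
          reflect : ∀ ν → p A′.[ ν ]ᶠ A′.≈ᶠ toᶠ {nonempty Y} (preimage B.[ lift ν ]ᶠ)
          reflect ν = F.trans
            (F.sym (A′.[]ᶠ-cong toᶠ-preimage
              (λ x → proj₂ (onto (ν x)) (Setoid.refl (B.terms (refine (λ _ → inj₁ tt) Y))))))
            (F.sym ([]ᶠ-homo preimage (lift ν)))

      -- If the preimage of a non-closed `p` were closed in the model, `preimage-same` and
      -- `closed-of` would make `p` closed. The infinite member supplies the two distinct variables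
      -- for `closed-of`.
      model-nontrivial : HasInfiniteMember S → Nontrivial (restrict {S = S} (λ _ → tt) A′) →
        Nontrivial (restrict {S = S ∪∅} (map₁ (λ _ → tt)) B)
      model-nontrivial (I , I∈S , I-infinite) (X , ne , p , ¬closed) =
        refine inj₁ X , ne , preimage {X} {{ne}} p , λ closed → ¬closed λ {Y} →
          closed-of (restrict {S = S} (λ _ → tt) A′) (I , irr I∈S) i j (j∉ ∘ here ∘ sym) {X} {{ne}} p
            (λ {Y} → preimage-same {X} {{ne}} p (λ {Y} σ τ → closed {refine inj₁ Y} σ τ (λ _ ())) {Y})
            {Y}
        where
        i = proj₁ (fresh I-infinite [])
        j = proj₁ (fresh I-infinite (i ∷ []))
        j∉ = proj₂ (fresh I-infinite (i ∷ []))

open Classical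

theorem6 : (em : ∀ {a} → ExcludedMiddle a) →
    ∀ {ℓ s} (S : Pred (Set ℓ) s) → HasInfiniteMember S →
    let open Theory {ℓ} em in
    ( (A : QuantifierTheory S) → Nontrivial A → LocallyFinite A →
    Σ[ A′ ∈ GlobalTheory ]
    (Nontrivial A′ × LocallyFinite A′ × A ≅ restrict (λ _ → tt) A′) )
    ×
    ( (A′ : GlobalTheory) → Nontrivial A′ →
    (B : QuantifierTheory (U ∪∅)) → Nontrivial B → IsModel A′ B →
    IsModel (restrict (λ _ → tt) A′) (restrict {S = S ∪∅} (map₁ (λ _ → tt)) B)
    × (Nontrivial (restrict {S = S} (λ _ → tt) A′) →
    Nontrivial (restrict {S = S ∪∅} (map₁ (λ _ → tt)) B)) )
theorem6 em S infinite =
  (λ A nontrivial lf → let open Globalize em infinite A lf in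
    globalization ,
    nontrivial-extension em A globalization globalization-restricts nontrivial ,
    globalization-locallyFinite ,
    globalization-restricts) ,
  (λ A′ _ B _ model → model-restriction em S A′ B model , model-nontrivial em S A′ B model infinite)
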